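{- Let $t\not\equiv 0\pmod 4$ be a fixed positive integer and let $n$ and $k<n$ be positive integers such that $t\mid 2nk$ and such that one of the following holds: (1) $nk$ is odd, $n\geq k\geq 3$, and $\gcd(n,k-1)=1$; (2) $nk$ is odd, $n\geq k$, and $3<k<200$; (3) $nk$ is odd, $n\geq k\geq 3$, and $n\geq (k-2)(k-1)$. Then the number of non-isomorphic biembeddings $\Pi$ of $K_{\frac{2nk+t}{t}\times t}$ such that (a) $\mathrm{Aut}(\Pi)=\mathbb{Z}_{2nk+t}$, (b) the faces determined by $\Pi$ have lengths multiples of $k$, is, setting $v=2nk+t$, at least $$\left(1-O\left(\tfrac{1}{nk}\right)\right)\frac{(nk)!}{2\phi(2nk+t)}=(1-o(1))\frac{\left(\frac{v-t}{2}\right)!}{2\phi(v)}.$$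
   Context: $\phi(\cdot)$ is Euler's totient function. Asymptotic convention: $t$ is fixed, the constant implied in $O(\cdot)$ depends only on $t$, and $o(1)$ is for $nk\to\infty$. $K_{\frac{v}{t}\times t}$ is the complete multipartite graph with $v/t$ parts of size $t$; its vertex set is identified with $\mathbb{Z}_v$, two vertices being adjacent iff their difference is not in the subgroup $J=\frac{v}{t}\mathbb{Z}_v$ of order $t$. A (combinatorial, orientable) embedding of a connected graph $\Gamma$ is a pair $\Pi=(\Gamma,\rho)$ where $\rho$ is a permutation of the oriented edges with $\rho(x,y)=(x,\rho_x(y))$, each $\rho_x$ being a cyclic permutation of all neighbours of $x$; this is equivalent to a cellular embedding into an orientable surface. Face boundaries are traced by the orbits of $(x,y)\mapsto\rho(y,x)$; the length of a face is the length of the orbit. A biembedding is an embedding whose faces can be coloured with two colours so that each edge lies on one face of each colour. Two embeddings $(\Gamma,\rho)$ and $(\Gamma',\rho')$ are isomorphic if there is a graph isomorphism $\sigma:\Gamma\to\Gamma'$ (acting on oriented edges by $\sigma(x,y)=(\sigma(x),\sigma(y))$) such that either $\sigma\circ\rho=\rho'\circ\sigma$ or $\sigma\circ\rho=(\rho')^{ -1}\circ\sigma$. $\mathrm{Aut}(\Pi)$ is the group of isomorphisms from $\Pi$ to itself; $\mathrm{Aut}(\Pi)=\mathbb{Z}_v$ means that it consists exactly of the translations $\tau_g(x)=x+g$, $g\in\mathbb{Z}_v$. -}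

module Defs where

open import Data.Bool.Base using (Bool)
open import Data.Fin.Base using (Fin; toℕ)
open import Data.Fin.Properties using (toℕ-fromℕ<; toℕ<n; toℕ-injective)
open import Data.Integer.Base using (+_)
open import Data.List.Base using (length; filter; map; upTo; applyUpTo)
open import Data.List.Properties using (filter-accept)
open import Data.Nat.Base hiding (_^_)
open import Data.Nat.Coprimality using (coprime?; 1-coprimeTo)
open import Data.Nat.DivMod
open import Data.Nat.Divisibility
open import Data.Nat.GCD using (gcd)
open import Data.Nat.Properties
open import Data.Nat.Tactic.RingSolver using (solve-∀)
open import Data.Product.Base using (Σ-syntax; ∃-syntax; _×_; _,_)
open import Data.Rational.Base as ℚ using (ℚ)
open import Data.Sum.Base using (_⊎_)
open import Function.Base using (_∘_)
open import Function.Bundles using (_↔_; _⇔_; module Inverse; module Equivalence)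
import Function.Endo.Propositional as Endo
open import Relation.Binary.Construct.Closure.ReflexiveTransitive using (Star)
open import Relation.Binary.PropositionalEquality
  using (_≡_; _≢_; refl; sym; trans; cong; cong₂; subst; module ≡-Reasoning)
open import Relation.Nullary using (¬_)

φ : ℕ → ℕ
φ v = length (filter (λ a → coprime? a v) (map suc (upTo v)))

φ-nonZero : ∀ v .{{_ : NonZero v}} → NonZero (φ v)
φ-nonZero (suc n) = subst (NonZero ∘ length)
  (sym (filter-accept (λ a → coprime? a (suc n))
    {x = 1} {xs = map suc (applyUpTo suc n)} (1-coprimeTo (suc n))))
  _

-- ℤ_v is carried by Fin v, and z ∈⟨ m ⟩ says z ∈ mℤ_v.
module _ {v : ℕ} .{{_ : NonZero v}} where

  infixl 6 _⊕_ _⊖_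
  infixl 7 _·_

  _⊕_ : Fin v → Fin v → Fin v
  x ⊕ y = (toℕ x + toℕ y) mod v

  _⊖_ : Fin v → Fin v → Fin v
  x ⊖ y = (toℕ x + (v ∸ toℕ y)) mod v

  _·_ : ℕ → Fin v → Fin v
  m · x = (m * toℕ x) mod v

  infix 4 _∈⟨_⟩
  _∈⟨_⟩ : Fin v → ℕ → Set
  z ∈⟨ m ⟩ = ∃[ w ] z ≡ m · w

  private
    mod-cong : ∀ {a b} → a % v ≡ b % v → a mod v ≡ b mod v
    mod-cong eq = toℕ-injective
      (trans (toℕ-fromℕ< _) (trans eq (sym (toℕ-fromℕ< _))))

    mod-cong⁻¹ : ∀ {a b} → a mod v ≡ b mod v → a % v ≡ b % v
    mod-cong⁻¹ eq =
      trans (sym (toℕ-fromℕ< _)) (trans (cong toℕ eq) (toℕ-fromℕ< _))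

    inverse-unique : ∀ p q r → v ∣ p + r → v ∣ q + r → p % v ≡ q % v
    inverse-unique p q r v∣p+r v∣q+r = begin
      p % v              ≡⟨ %-remove-+ʳ p v∣q+r ⟨
      (p + (q + r)) % v  ≡⟨ cong (_% v) (rearrange p q r) ⟩
      (q + (p + r)) % v  ≡⟨ %-remove-+ʳ q v∣p+r ⟩
      q % v              ∎
      where
      open ≡-Reasoning
      rearrange : ∀ p q r → p + (q + r) ≡ q + (p + r)
      rearrange = solve-∀

    ∣-cong-% : ∀ p q r → q % v ≡ r % v → v ∣ p + q → v ∣ p + r
    ∣-cong-% p q r eq v∣p+q = m%n≡0⇒n∣m (p + r) v (begin
      (p + r) % v              ≡⟨ %-distribˡ-+ p r v ⟩
      (p % v + r % v) % v      ≡⟨ cong (λ s → (p % v + s) % v) eq ⟨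
      (p % v + q % v) % v      ≡⟨ %-distribˡ-+ p q v ⟨
      (p + q) % v              ≡⟨ n∣m⇒m%n≡0 (p + q) v v∣p+q ⟩
      0                        ∎)
      where open ≡-Reasoning

    opposite : ∀ a b → a ≤ v → b ≤ v → v ∣ (a + (v ∸ b)) + (b + (v ∸ a))
    opposite a b a≤v b≤v = subst (v ∣_) (sym eq) (∣m∣n⇒∣m+n ∣-refl ∣-refl)
      where
      open ≡-Reasoning
      rearrange : ∀ a b c d → (a + c) + (b + d) ≡ (a + d) + (b + c)
      rearrange = solve-∀
      eq : (a + (v ∸ b)) + (b + (v ∸ a)) ≡ v + v
      eq = begin
        (a + (v ∸ b)) + (b + (v ∸ a))  ≡⟨ rearrange a b (v ∸ b) (v ∸ a) ⟩
        (a + (v ∸ a)) + (b + (v ∸ b))  ≡⟨ cong₂ _+_ (m+[n∸m]≡n a≤v) (m+[n∸m]≡n b≤v) ⟩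
        v + v                          ∎

  ⊖-self-∈ : ∀ m (x : Fin v) → x ⊖ x ∈⟨ m ⟩
  ⊖-self-∈ m x = 0 mod v , mod-cong (begin
    (toℕ x + (v ∸ toℕ x)) % v  ≡⟨ cong (_% v) (m+[n∸m]≡n (<⇒≤ (toℕ<n x))) ⟩
    v % v                      ≡⟨ n∣m⇒m%n≡0 v v ∣-refl ⟩
    0                          ≡⟨ n∣m⇒m%n≡0 0 v (v ∣0) ⟨
    0 % v                      ≡⟨ cong (_% v) (*-zeroʳ m) ⟨
    (m * 0) % v                ≡⟨ cong (λ s → (m * s) % v) zero-mod ⟨
    (m * toℕ (0 mod v)) % v    ∎)
    where
    open ≡-Reasoning
    zero-mod : toℕ (0 mod v) ≡ 0
    zero-mod = trans (toℕ-fromℕ< _) (n∣m⇒m%n≡0 0 v (v ∣0))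

  ⊖-swap-∈ : ∀ m (x y : Fin v) → x ⊖ y ∈⟨ m ⟩ → y ⊖ x ∈⟨ m ⟩
  ⊖-swap-∈ m x y (w , eq) = w′ , mod-cong
    (inverse-unique _ (m * toℕ w′) (toℕ x + (v ∸ toℕ y))
      (opposite (toℕ y) (toℕ x) (<⇒≤ (toℕ<n y)) (<⇒≤ (toℕ<n x)))
      (∣-cong-% (m * toℕ w′) (m * toℕ w) _ (sym (mod-cong⁻¹ eq))
        (subst (v ∣_) (*-distribˡ-+ m (toℕ w′) (toℕ w)) (∣n⇒∣m*n m v∣w′+w))))
    where
    w′ : Fin v
    w′ = (v ∸ toℕ w) mod v

    v∣w+w′ : v ∣ toℕ w + toℕ w′
    v∣w+w′ = ∣-cong-% (toℕ w) (v ∸ toℕ w) (toℕ w′)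
      (sym (trans (cong (_% v) (toℕ-fromℕ< _)) (m%n%n≡m%n (v ∸ toℕ w) v)))
      (subst (v ∣_) (sym (m+[n∸m]≡n (<⇒≤ (toℕ<n w)))) ∣-refl)

    v∣w′+w : v ∣ toℕ w′ + toℕ w
    v∣w′+w = subst (v ∣_) (+-comm (toℕ w) (toℕ w′)) v∣w+w′

record Graph (N : ℕ) : Set₁ where
  field
    Adj     : Fin N → Fin N → Set
    symm    : ∀ {x y} → Adj x y → Adj y x
    irrefl  : ∀ {x} → ¬ Adj x x

open Graph

Connected : ∀ {N} → Graph N → Set
Connected Γ = ∀ x y → Star (Adj Γ) x y

-- The adjacency proof is irrelevant, so an oriented edge is determined by
-- its two ends.
record OEdge {N} (Γ : Graph N) : Set where
  constructor edge
  field
    src tgt : Fin N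
    .adj    : Adj Γ src tgt

open OEdge

reverse : ∀ {N} {Γ : Graph N} → OEdge Γ → OEdge Γ
reverse {Γ = Γ} (edge x y a) = edge y x (symm Γ a)

record GraphIso {N N′} (Γ : Graph N) (Γ′ : Graph N′) : Set where
  field
    bij     : Fin N ↔ Fin N′
    adj-iff : ∀ x y → Adj Γ x y ⇔ Adj Γ′ (Inverse.to bij x) (Inverse.to bij y)

  onVertex : Fin N → Fin N′
  onVertex = Inverse.to bij

  onEdge : OEdge Γ → OEdge Γ′
  onEdge (edge x y a) =
    edge (onVertex x) (onVertex y) (Equivalence.to (adj-iff x y) a)

-- Vertices in the same part are those whose difference lies in the subgroup
-- J = (v/t)ℤ_v; this has order t when t divides v.
completeMultipartite : (v t : ℕ) .{{_ : NonZero v}} .{{_ : NonZero t}} → Graph v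
completeMultipartite v t = record
  { Adj    = λ x y → ¬ (x ⊖ y ∈⟨ v / t ⟩)
  ; symm   = λ {x} {y} x≁y → x≁y ∘ ⊖-swap-∈ (v / t) y x
  ; irrefl = λ {x} x≁x → x≁x (⊖-self-∈ (v / t) x)
  }

-- ρ-src makes ρ act on the neighbours of each vertex, and ρ-cyclic makes
-- that action transitive, i.e. a single cycle through all neighbours.
record Embedding {N} (Γ : Graph N) : Set where
  open Endo (OEdge Γ) using (_^_)
  field
    connected : Connected Γ
    ρ         : OEdge Γ ↔ OEdge Γ
    ρ-src     : ∀ e → src (Inverse.to ρ e) ≡ src e
    ρ-cyclic  : ∀ e e′ → src e ≡ src e′ → ∃[ i ] (Inverse.to ρ ^ i) e ≡ e′

  rot rot⁻¹ : OEdge Γ → OEdge Γ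
  rot   = Inverse.to ρ
  rot⁻¹ = Inverse.from ρ

  trace : OEdge Γ → OEdge Γ
  trace e = rot (reverse e)

  SameFace : OEdge Γ → OEdge Γ → Set
  SameFace e e′ = ∃[ i ] (trace ^ i) e ≡ e′

  FaceLength : OEdge Γ → ℕ → Set
  FaceLength e ℓ =
    0 < ℓ × (trace ^ ℓ) e ≡ e × (∀ i → 0 < i → i < ℓ → (trace ^ i) e ≢ e)

  -- A colouring of faces is a colouring of oriented edges constant on the
  -- orbits of trace; the two sides of an edge are e and reverse e.
  IsBiembedding : Set
  IsBiembedding =
    Σ[ colour ∈ (OEdge Γ → Bool) ]
      (∀ e e′ → SameFace e e′ → colour e ≡ colour e′) ×
      (∀ e → colour e ≢ colour (reverse e))

  FaceLengthsMultipleOf : ℕ → Set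
  FaceLengthsMultipleOf k = ∀ e ℓ → FaceLength e ℓ → k ∣ ℓ

open Embedding

record Isomorphism {N N′} {Γ : Graph N} {Γ′ : Graph N′}
                   (Π : Embedding Γ) (Π′ : Embedding Γ′) : Set where
  field
    σ      : GraphIso Γ Γ′
  open GraphIso σ public
  field
    compat : (∀ e → onEdge (rot Π e) ≡ rot Π′ (onEdge e))
           ⊎ (∀ e → onEdge (rot Π e) ≡ rot⁻¹ Π′ (onEdge e))

AutIsTranslations : ∀ {v} .{{_ : NonZero v}} {Γ : Graph v} → Embedding Γ → Set
AutIsTranslations {v} Π =
  (∀ (g : Fin v) → Σ[ α ∈ Isomorphism Π Π ] ∀ x → Isomorphism.onVertex α x ≡ x ⊕ g) ×
  (∀ (α : Isomorphism Π Π) → Σ[ g ∈ Fin v ] ∀ x → Isomorphism.onVertex α x ≡ x ⊕ g)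

-- There are at least q isomorphism classes of embeddings satisfying P:
-- some N ≥ q pairwise non-isomorphic embeddings satisfy P.
NonIsomorphic≥ : ∀ {N} {Γ : Graph N} → (Embedding Γ → Set) → ℚ → Set
NonIsomorphic≥ {Γ = Γ} P q =
  Σ[ N ∈ ℕ ] Σ[ Π ∈ (Fin N → Embedding Γ) ]
    (∀ i → P (Π i)) ×
    (∀ i j → i ≢ j → ¬ Isomorphism (Π i) (Π j)) ×
    q ℚ.≤ (+ N) ℚ./ 1

Admissible : (t n k : ℕ) → Set
Admissible t n k =
  k < n × t ∣ 2 * n * k ×
  ( ((n * k) % 2 ≡ 1 × k ≤ n × 3 ≤ k × gcd n (k ∸ 1) ≡ 1)
  ⊎ ((n * k) % 2 ≡ 1 × k ≤ n × 3 < k × k < 200)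
  ⊎ ((n * k) % 2 ≡ 1 × k ≤ n × 3 ≤ k × (k ∸ 2) * (k ∸ 1) ≤ n))

GoodBiembedding : (v t k : ℕ) .{{_ : NonZero v}} .{{_ : NonZero t}} →
                  Embedding (completeMultipartite v t) → Set
GoodBiembedding v t k Π =
  IsBiembedding Π × AutIsTranslations Π × FaceLengthsMultipleOf Π k

_!/2φ_ : (a v : ℕ) .{{_ : NonZero v}} → ℚ
a !/2φ v = ℚ._/_ (+ (a !)) (2 * φ v) {{m*n≢0 2 (φ v) {{_}} {{φ-nonZero v}}}}

{-# OPTIONS --safe #-}

-- Let m = nk, which is odd, and let e₀, …, e₍ₘ₋₁₎ enumerate a set E that contains
-- exactly one of x and -x for every x ∉ J.  At each vertex let the rotation run
-- through the differences e₀, -e₍ₘ₋₁₎, e₁, -e₀, e₂, -e₁, ….  A face then uses only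
-- differences from E, advancing the index by 2, or only differences from -E,
-- moving the index back by 1; this gives the two colours, and as m is odd all
-- face lengths are multiples of m.
--
-- Translations are automorphisms.  If σ is an isomorphism between two such
-- embeddings, its action at each vertex intertwines the rotations.  Provided
-- 1, 2 ∈ E, the relation 1 + 1 = 2 forces these local actions to coincide and to
-- respect the colours, so that σ(x) = σ(0) + u x with u E = ±E′.  If moreover E and
-- E′ both contain every x ≤ R outside J, where R is close to v/2, then u = ±1, since
-- for every other u some x ≤ R outside J has its multiple ±u x in [v - R , v);
-- prescribing e₀ = 1 and e₁ = 2 excludes the remaining shifts and reflections.  The other m - 2 positions and
-- the signs of the q = O(log m) largest elements are free, and they give
-- (m - 2)! 2^q ≥ m! pairwise non-isomorphic embeddings for all large m.
module Submission where

open import Defs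
open import Algebra.Bundles using (AbelianGroup)
import Algebra.Properties.AbelianGroup as AbelianGroupProperties
open import Data.Bool.Base using (Bool; true; false; not; _xor_)
open import Data.Bool.Properties using (not-¬; xor-same)
open import Data.Empty using (⊥; ⊥-elim; ⊥-elim-irr)
open import Data.Fin.Base using (Fin; zero; suc; toℕ; fromℕ<; opposite; inject≤; quotient; remainder; combine; punchIn; finToFun)
open import Data.Fin.Permutation as Perm using (Permutation′; _⟨$⟩ʳ_; _⟨$⟩ˡ_; lift₀; insert; insert-punchIn)
open import Data.Fin.Properties using (toℕ<n; toℕ-injective; toℕ-inject≤; toℕ-fromℕ<; suc-injective; opposite-prop; opposite-involutive; combine-remQuot; punchIn-injective)
open import Data.Integer.Base as ℤ using (+_)
import Data.Integer.Properties as ℤ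
open import Data.Nat.Base as ℕ hiding (_^_)
open import Data.Nat.DivMod
open import Data.Nat.Divisibility hiding (quotient)
open import Data.Nat.Properties hiding (suc-injective)
open import Data.Nat.Tactic.RingSolver using (solve-∀)
open import Data.Product.Base using (Σ-syntax; ∃-syntax; _×_; _,_; proj₁; proj₂)
open import Data.Rational.Base as ℚ using (ℚ; 0ℚ; 1ℚ)
import Data.Rational.Properties as ℚ
import Data.Rational.Unnormalised.Base as ℚᵘ
import Data.Rational.Unnormalised.Properties as ℚᵘ
open import Data.Sum.Base using (inj₁; inj₂)
open import Function.Base using (_∘_)
open import Function.Bundles using (_↔_; mk↔ₛ′; mk⇔)
import Function.Endo.Propositional as Endo
open import Level using (0ℓ)
open import Relation.Binary.Construct.Closure.ReflexiveTransitive as Star using (Star)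
open import Relation.Binary.Definitions using (tri<; tri≈; tri>)
open import Relation.Binary.PropositionalEquality
open import Relation.Binary.PropositionalEquality.Algebra using (isMagma)
open import Relation.Nullary using (¬_; Dec; yes; no)

open OEdge
open Graph

-- Arithmetic modulo v

module _ {v : ℕ} .{{_ : NonZero v}} where

  infix 8 ⊝_

  ⊝_ : Fin v → Fin v
  ⊝ x = (v ∸ toℕ x) mod v

  toℕ-mod : ∀ a → toℕ (a mod v) ≡ a % v
  toℕ-mod a = toℕ-fromℕ< (m%n<n a v)

  mod-cong : ∀ {a b} → a % v ≡ b % v → a mod v ≡ b mod v
  mod-cong {a} {b} eq = toℕ-injective (trans (toℕ-mod a) (trans eq (sym (toℕ-mod b))))

  toℕ-mod-< : ∀ {a} → a < v → toℕ (a mod v) ≡ a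
  toℕ-mod-< {a} a<v = trans (toℕ-mod a) (m<n⇒m%n≡m a<v)

  mod-toℕ : ∀ (x : Fin v) → toℕ x mod v ≡ x
  mod-toℕ x = toℕ-injective (toℕ-mod-< (toℕ<n x))

  mod-+ : ∀ a b → (a + b) mod v ≡ a mod v ⊕ b mod v
  mod-+ a b = mod-cong (trans (%-distribˡ-+ a b v)
    (cong₂ (λ x y → (x + y) % v) (sym (toℕ-mod a)) (sym (toℕ-mod b))))

  v-mod-v : v mod v ≡ 0 mod v
  v-mod-v = mod-cong (trans (n%n≡0 v) (sym (n∣m⇒m%n≡0 0 v (v ∣0))))

  ⊖-def : ∀ (x y : Fin v) → x ⊖ y ≡ x ⊕ ⊝ y
  ⊖-def x y = trans (mod-+ (toℕ x) (v ∸ toℕ y)) (cong (_⊕ ⊝ y) (mod-toℕ x))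

  ⊕-comm : ∀ (x y : Fin v) → x ⊕ y ≡ y ⊕ x
  ⊕-comm x y = cong (_mod v) (+-comm (toℕ x) (toℕ y))

  ⊕-assoc : ∀ (x y z : Fin v) → (x ⊕ y) ⊕ z ≡ x ⊕ (y ⊕ z)
  ⊕-assoc x y z = begin
    (x ⊕ y) ⊕ z                              ≡⟨ cong ((x ⊕ y) ⊕_) (mod-toℕ z) ⟨
    (toℕ x + toℕ y) mod v ⊕ toℕ z mod v      ≡⟨ mod-+ (toℕ x + toℕ y) (toℕ z) ⟨
    (toℕ x + toℕ y + toℕ z) mod v            ≡⟨ cong (_mod v) (+-assoc (toℕ x) (toℕ y) (toℕ z)) ⟩
    (toℕ x + (toℕ y + toℕ z)) mod v          ≡⟨ mod-+ (toℕ x) (toℕ y + toℕ z) ⟩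
    toℕ x mod v ⊕ (y ⊕ z)                    ≡⟨ cong (_⊕ (y ⊕ z)) (mod-toℕ x) ⟩
    x ⊕ (y ⊕ z)                              ∎
    where open ≡-Reasoning

  ⊕-identityˡ : ∀ (x : Fin v) → 0 mod v ⊕ x ≡ x
  ⊕-identityˡ x = begin
    0 mod v ⊕ x            ≡⟨ cong (0 mod v ⊕_) (mod-toℕ x) ⟨
    0 mod v ⊕ toℕ x mod v  ≡⟨ mod-+ 0 (toℕ x) ⟨
    toℕ x mod v            ≡⟨ mod-toℕ x ⟩
    x                      ∎
    where open ≡-Reasoning

  ⊕-inverseʳ : ∀ (x : Fin v) → x ⊕ ⊝ x ≡ 0 mod v
  ⊕-inverseʳ x = begin
    x ⊕ ⊝ x                      ≡⟨ ⊖-def x x ⟨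
    (toℕ x + (v ∸ toℕ x)) mod v  ≡⟨ cong (_mod v) (m+[n∸m]≡n (<⇒≤ (toℕ<n x))) ⟩
    v mod v                      ≡⟨ v-mod-v ⟩
    0 mod v                      ∎
    where open ≡-Reasoning

ℤ/ : (v : ℕ) .{{_ : NonZero v}} → AbelianGroup 0ℓ 0ℓ
ℤ/ v = record
  { Carrier = Fin v ; _≈_ = _≡_ ; _∙_ = _⊕_ ; ε = 0 mod v ; _⁻¹ = ⊝_
  ; isAbelianGroup = record
    { isGroup = record
      { isMonoid = record
        { isSemigroup = record
          { isMagma = isMagma _⊕_
          ; assoc = ⊕-assoc }
        ; identity = ⊕-identityˡ , λ x → trans (⊕-comm x _) (⊕-identityˡ x) }
      ; inverse = (λ x → trans (⊕-comm _ x) (⊕-inverseʳ x)) , ⊕-inverseʳ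
      ; ⁻¹-cong = cong ⊝_ }
    ; comm = ⊕-comm } }

module _ {v : ℕ} .{{_ : NonZero v}} where

  open AbelianGroup (ℤ/ v) public using () renaming (identityʳ to ⊕-identityʳ; inverseˡ to ⊕-inverseˡ)
  open AbelianGroupProperties (ℤ/ v) public using ()
    renaming ( ∙-cancelˡ to ⊕-cancelˡ
             ; ⁻¹-involutive to ⊝-involutive; ⁻¹-∙-comm to ⊝-⊕-comm
             ; xyx⁻¹≈y to x⊕y⊝x≡y
             ; //-rightDividesˡ to x⊝y⊕y≡x; //-rightDividesʳ to x⊕y⊝y≡x
             ; inverseˡ-unique to ⊝-uniqueˡ
             )

  [x⊕y]⊖x≡y : ∀ (x y : Fin v) → (x ⊕ y) ⊖ x ≡ y
  [x⊕y]⊖x≡y x y = trans (⊖-def (x ⊕ y) x) (x⊕y⊝x≡y x y)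

  x⊕[y⊖x]≡y : ∀ (x y : Fin v) → x ⊕ (y ⊖ x) ≡ y
  x⊕[y⊖x]≡y x y = trans (⊕-comm x (y ⊖ x))
    (trans (cong (_⊕ x) (⊖-def y x)) (x⊝y⊕y≡x x y))

  [x⊕z]⊖[y⊕z]≡x⊖y : ∀ (x y z : Fin v) → (x ⊕ z) ⊖ (y ⊕ z) ≡ x ⊖ y
  [x⊕z]⊖[y⊕z]≡x⊖y x y z = begin
    (x ⊕ z) ⊖ (y ⊕ z)        ≡⟨ ⊖-def (x ⊕ z) (y ⊕ z) ⟩
    (x ⊕ z) ⊕ ⊝ (y ⊕ z)      ≡⟨ cong ((x ⊕ z) ⊕_) (⊝-⊕-comm y z) ⟨
    (x ⊕ z) ⊕ (⊝ y ⊕ ⊝ z)    ≡⟨ cong ((x ⊕ z) ⊕_) (⊕-comm (⊝ y) (⊝ z)) ⟩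
    (x ⊕ z) ⊕ (⊝ z ⊕ ⊝ y)    ≡⟨ ⊕-assoc (x ⊕ z) (⊝ z) (⊝ y) ⟨
    ((x ⊕ z) ⊕ ⊝ z) ⊕ ⊝ y    ≡⟨ cong (_⊕ ⊝ y) (x⊕y⊝y≡x z x) ⟩
    x ⊕ ⊝ y                  ≡⟨ ⊖-def x y ⟨
    x ⊖ y                    ∎
    where open ≡-Reasoning

  mod-suc : ∀ a → suc a mod v ≡ a mod v ⊕ 1 mod v
  mod-suc a = trans (cong (_mod v) (+-comm 1 a)) (mod-+ a 1)

  mod-≡⇒%-≡ : ∀ a b → a mod v ≡ b mod v → a % v ≡ b % v
  mod-≡⇒%-≡ a b eq = trans (sym (toℕ-mod a)) (trans (cong toℕ eq) (toℕ-mod b))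

  toℕ-⊝ : ∀ x → toℕ x ≢ 0 → toℕ (⊝ x) ≡ v ∸ toℕ x
  toℕ-⊝ x x≢0 = toℕ-mod-< (∸-monoʳ-< (n≢0⇒n>0 x≢0) (<⇒≤ (toℕ<n x)))

  module _ {w : ℕ} (w∣v : w ∣ v) where

    -- Because `w` divides `v`, reduction modulo `v` keeps divisibility by `w`; membership in the
    -- subgroup generated by `w` can therefore be tested on representatives.
    ∈⟨⟩⇒∣ : ∀ {z} → z ∈⟨ w ⟩ → w ∣ toℕ z
    ∈⟨⟩⇒∣ (y , refl) = subst (w ∣_) (sym (toℕ-mod (w * toℕ y)))
      (%-presˡ-∣ (m∣m*n (toℕ y)) w∣v)

    ∣⇒∈⟨⟩ : ∀ {z} → w ∣ toℕ z → z ∈⟨ w ⟩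
    ∣⇒∈⟨⟩ {z} (divides q eq) = q mod v , (begin
      z                                ≡⟨ mod-toℕ z ⟨
      toℕ z mod v                      ≡⟨ mod-cong (begin
        toℕ z % v                         ≡⟨ cong (_% v) (trans eq (*-comm q w)) ⟩
        (w * q) % v                       ≡⟨ %-distribˡ-* w q v ⟩
        ((w % v) * (q % v)) % v           ≡⟨ cong (λ s → ((w % v) * s) % v) (m%n%n≡m%n q v) ⟨
        ((w % v) * (q % v % v)) % v       ≡⟨ %-distribˡ-* w (q % v) v ⟨
        (w * (q % v)) % v                 ≡⟨ cong (λ s → (w * s) % v) (toℕ-mod q) ⟨
        (w * toℕ (q mod v)) % v           ∎) ⟩
      w · (q mod v)                    ∎)
      where open ≡-Reasoning

-- Rotation in coordinates

-- With E the labels of colour true, (true , j) stands for the j-th element of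
-- E and (false , j) for the negative of the (j - 1)-th one; next is the
-- rotation and opp is negation.
Place : ℕ → Set
Place m = Bool × Fin m

module _ {m : ℕ} .{{_ : NonZero m}} where

  open Endo (Place m) using (_^_; ^-homo)

  𝟙 : Fin m
  𝟙 = 1 mod m

  next prev opp : Place m → Place m
  next (true  , j) = false , j
  next (false , j) = true  , j ⊕ 𝟙
  prev (true  , j) = false , j ⊕ ⊝ 𝟙
  prev (false , j) = true  , j
  opp  (true  , j) = false , j ⊕ 𝟙
  opp  (false , j) = true  , j ⊕ ⊝ 𝟙

  shift : Fin m → Place m → Place m
  shift k (c , j) = c , j ⊕ k

  turn : Bool → Place m → Place m
  turn true  = next
  turn false = prev

  next-prev : ∀ p → next (prev p) ≡ p
  next-prev (true  , j) = cong (true ,_) (x⊝y⊕y≡x 𝟙 j)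
  next-prev (false , j) = refl

  prev-next : ∀ p → prev (next p) ≡ p
  prev-next (true  , j) = refl
  prev-next (false , j) = cong (false ,_) (x⊕y⊝y≡x 𝟙 j)

  opp-involutive : ∀ p → opp (opp p) ≡ p
  opp-involutive (true  , j) = cong (true  ,_) (x⊕y⊝y≡x 𝟙 j)
  opp-involutive (false , j) = cong (false ,_) (x⊝y⊕y≡x 𝟙 j)

  opp-colour : ∀ p → proj₁ (opp p) ≡ not (proj₁ p)
  opp-colour (true  , j) = refl
  opp-colour (false , j) = refl

  ⊕-swapʳ : ∀ (x y z : Fin m) → x ⊕ y ⊕ z ≡ x ⊕ z ⊕ y
  ⊕-swapʳ x y z = trans (⊕-assoc x y z)
    (trans (cong (x ⊕_) (⊕-comm y z)) (sym (⊕-assoc x z y)))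

  turn-shift : ∀ o k p → turn o (shift k p) ≡ shift k (turn o p)
  turn-shift true  k (true  , j) = refl
  turn-shift true  k (false , j) = cong (true ,_) (⊕-swapʳ j k 𝟙)
  turn-shift false k (true  , j) = cong (false ,_) (⊕-swapʳ j k (⊝ 𝟙))
  turn-shift false k (false , j) = refl

  turn²-colour : ∀ o p → proj₁ (turn o (turn o p)) ≡ proj₁ p
  turn²-colour true  (true  , j) = refl
  turn²-colour true  (false , j) = refl
  turn²-colour false (true  , j) = refl
  turn²-colour false (false , j) = refl

  next²-iterate : ∀ i j → (next ^ (i * 2)) (true , j) ≡ (true , j ⊕ i mod m)
  next²-iterate zero    j = cong (true ,_) (sym (⊕-identityʳ j))
  next²-iterate (suc i) j = trans (cong (next ∘ next) (next²-iterate i j))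
    (cong (true ,_) (trans (⊕-assoc j _ _) (cong (j ⊕_) (sym (mod-suc i)))))

  Reaches : Place m → Place m → Set
  Reaches p p′ = ∃[ i ] (next ^ i) p ≡ p′

  Reaches-trans : ∀ {p q r} → Reaches p q → Reaches q r → Reaches p r
  Reaches-trans {p} (i , refl) (i′ , refl) = i′ + i , cong-app (^-homo next i′ i) p

  -- Two steps of `next` raise the index within colour true by 1, so they run through all these
  -- places; a place of colour false lies one step after and one step before places of colour true.
  -- This makes the rotation at a vertex a single cycle.
  next-transitive : ∀ p p′ → Reaches p p′
  next-transitive p p′ = Reaches-trans (proj₂ (forward p))
    (Reaches-trans (within _ _) (proj₂ (backward p′)))
    where
    forward : ∀ p → Σ[ j ∈ Fin m ] Reaches p (true , j)
    forward (true  , j) = j , 0 , refl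
    forward (false , j) = j ⊕ 𝟙 , 1 , refl
    backward : ∀ p → Σ[ j ∈ Fin m ] Reaches (true , j) p
    backward (true  , j) = j , 0 , refl
    backward (false , j) = j , 1 , refl
    within : ∀ j j′ → Reaches (true , j) (true , j′)
    within j j′ = toℕ (j′ ⊖ j) * 2 , trans (next²-iterate (toℕ (j′ ⊖ j)) j)
      (cong (true ,_) (trans (cong (j ⊕_) (mod-toℕ _)) (x⊕[y⊖x]≡y j j′)))

  -- Maps that intertwine rotations

  Intertwines : Bool → (Place m → Place m) → Set
  Intertwines o A = ∀ p → A (next p) ≡ turn o (A p)

  -- `next` reaches every place from `p`, and each of its steps dictates the following value of an
  -- intertwiner.
  intertwiner-determined : ∀ o {A B} → Intertwines o A → Intertwines o B →
    ∀ p → A p ≡ B p → ∀ p′ → A p′ ≡ B p′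
  intertwiner-determined o {A} {B} A-int B-int p eq p′
    with i , refl ← next-transitive p p′ = iterate i
    where
    iterate : ∀ i → A ((next ^ i) p) ≡ B ((next ^ i) p)
    iterate zero    = eq
    iterate (suc i) = trans (A-int _) (trans (cong (turn o) (iterate i)) (sym (B-int _)))

  𝟛 : Fin m
  𝟛 = 𝟙 ⊕ 𝟙 ⊕ 𝟙

  -- An intertwiner need not commute with opp; twist o c is the defect at a
  -- place of colour true whose image has colour c.
  twist : Bool → Bool → Fin m
  twist true  true  = 0 mod m
  twist true  false = 𝟛
  twist false true  = ⊝ 𝟛
  twist false false = 0 mod m

  -- At colour true, `opp` is the cube of `next`. An intertwiner carries this cube to the cube of
  -- `turn o`, which is compared with `opp` here.
  turn³ : ∀ o p → turn o (turn o (turn o p)) ≡ shift (twist o (proj₁ p)) (opp p)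
  turn³ true  (true  , j) = cong (false ,_) (sym (⊕-identityʳ (j ⊕ 𝟙)))
  turn³ true  (false , j) = cong (true ,_) (sym (begin
    j ⊕ ⊝ 𝟙 ⊕ (𝟙 ⊕ 𝟙 ⊕ 𝟙)    ≡⟨ cong (j ⊕ ⊝ 𝟙 ⊕_) (⊕-assoc 𝟙 𝟙 𝟙) ⟩
    j ⊕ ⊝ 𝟙 ⊕ (𝟙 ⊕ (𝟙 ⊕ 𝟙))  ≡⟨ ⊕-assoc (j ⊕ ⊝ 𝟙) 𝟙 (𝟙 ⊕ 𝟙) ⟨
    j ⊕ ⊝ 𝟙 ⊕ 𝟙 ⊕ (𝟙 ⊕ 𝟙)    ≡⟨ cong (_⊕ (𝟙 ⊕ 𝟙)) (x⊝y⊕y≡x 𝟙 j) ⟩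
    j ⊕ (𝟙 ⊕ 𝟙)              ≡⟨ ⊕-assoc j 𝟙 𝟙 ⟨
    j ⊕ 𝟙 ⊕ 𝟙                ∎))
    where open ≡-Reasoning
  turn³ false (true  , j) = cong (false ,_) (sym (begin
    j ⊕ 𝟙 ⊕ ⊝ (𝟙 ⊕ 𝟙 ⊕ 𝟙)          ≡⟨ cong (λ x → j ⊕ 𝟙 ⊕ ⊝ x) (⊕-assoc 𝟙 𝟙 𝟙) ⟩
    j ⊕ 𝟙 ⊕ ⊝ (𝟙 ⊕ (𝟙 ⊕ 𝟙))        ≡⟨ cong (j ⊕ 𝟙 ⊕_) (⊝-⊕-comm 𝟙 (𝟙 ⊕ 𝟙)) ⟨
    j ⊕ 𝟙 ⊕ (⊝ 𝟙 ⊕ ⊝ (𝟙 ⊕ 𝟙))      ≡⟨ ⊕-assoc (j ⊕ 𝟙) (⊝ 𝟙) (⊝ (𝟙 ⊕ 𝟙)) ⟨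
    j ⊕ 𝟙 ⊕ ⊝ 𝟙 ⊕ ⊝ (𝟙 ⊕ 𝟙)        ≡⟨ cong (_⊕ ⊝ (𝟙 ⊕ 𝟙)) (x⊕y⊝y≡x 𝟙 j) ⟩
    j ⊕ ⊝ (𝟙 ⊕ 𝟙)                  ≡⟨ cong (j ⊕_) (⊝-⊕-comm 𝟙 𝟙) ⟨
    j ⊕ (⊝ 𝟙 ⊕ ⊝ 𝟙)                ≡⟨ ⊕-assoc j (⊝ 𝟙) (⊝ 𝟙) ⟨
    j ⊕ ⊝ 𝟙 ⊕ ⊝ 𝟙                  ∎))
    where open ≡-Reasoning
  turn³ false (false , j) = cong (true ,_) (sym (⊕-identityʳ (j ⊕ ⊝ 𝟙)))

  intertwiner-opp : ∀ o {A} → Intertwines o A → ∀ j →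
    A (opp (true , j)) ≡ shift (twist o (proj₁ (A (true , j)))) (opp (A (true , j)))
  intertwiner-opp o {A} A-int j = begin
    -- The triple `next` is `opp (true , j)` by definition.
    A (next (next (next (true , j))))          ≡⟨ A-int _ ⟩
    turn o (A (next (next (true , j))))        ≡⟨ cong (turn o) (A-int _) ⟩
    turn o (turn o (A (next (true , j))))      ≡⟨ cong (turn o ∘ turn o) (A-int _) ⟩
    turn o (turn o (turn o (A (true , j))))    ≡⟨ turn³ o _ ⟩
    shift _ (opp (A (true , j)))               ∎
    where open ≡-Reasoning

  -- A double turn keeps the colour in either direction, and double steps of `next` connect all
  -- places of colour true.
  intertwiner-colour : ∀ o {A} → Intertwines o A → ∀ j j′ →
    proj₁ (A (true , j)) ≡ proj₁ (A (true , j′))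
  intertwiner-colour o {A} A-int j j′ = sym (trans
    (cong (λ x → proj₁ (A (true , x)))
      (sym (trans (cong (j ⊕_) (mod-toℕ (j′ ⊖ j))) (x⊕[y⊖x]≡y j j′))))
    (trans (cong (proj₁ ∘ A) (sym (next²-iterate (toℕ (j′ ⊖ j)) j))) (iterate (toℕ (j′ ⊖ j)))))
    where
    iterate : ∀ i → proj₁ (A ((next ^ (i * 2)) (true , j))) ≡ proj₁ (A (true , j))
    iterate zero    = refl
    iterate (suc i) = trans
      (cong proj₁ (trans (A-int _) (cong (turn o) (A-int _))))
      (trans (turn²-colour o _) (iterate i))

  -- The index advance of a face step `next ∘ opp`. A step back by 1 is written `m ∸ 1`, so that the
  -- closing of a face becomes a divisibility between natural numbers.
  stride : Bool → ℕ
  stride true  = 2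
  stride false = m ∸ 1

  next-opp : ∀ c j → next (opp (c , j)) ≡ (c , j ⊕ stride c mod m)
  next-opp true  j = cong (true ,_) (trans (⊕-assoc j 𝟙 𝟙) (cong (j ⊕_) (sym (mod-+ 1 1))))
  next-opp false j = cong (λ x → false , j ⊕ x) (sym (⊝-uniqueˡ _ 𝟙 (begin
    (m ∸ 1) mod m ⊕ 𝟙   ≡⟨ mod-+ (m ∸ 1) 1 ⟨
    (m ∸ 1 + 1) mod m   ≡⟨ cong (_mod m) (m∸n+n≡m (>-nonZero⁻¹ m)) ⟩
    m mod m             ≡⟨ v-mod-v ⟩
    0 mod m             ∎)))
    where open ≡-Reasoning

-- Both strides are invertible modulo the odd number `m`: with `m` written as twice `m / 2` plus 1,
-- or as `m ∸ 1` plus 1, the product `ℓ * m` is a multiple of the given number plus `ℓ`.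
∣*stride⇒∣ : ∀ m .{{_ : NonZero m}} → m % 2 ≡ 1 → ∀ c ℓ → m ∣ ℓ * stride {m} c → m ∣ ℓ
∣*stride⇒∣ m m-odd true ℓ m∣2ℓ = ∣m+n∣m⇒∣n
  (subst (m ∣_) (trans (cong (ℓ *_) m≡) (trans (*-distribˡ-+ ℓ (m / 2 * 2) 1)
     (cong (λ x → ℓ * (m / 2 * 2) + x) (*-identityʳ ℓ)))) (n∣m*n ℓ))
  (subst (m ∣_) (trans (*-assoc ℓ 2 (m / 2)) (cong (ℓ *_) (*-comm 2 (m / 2)))) (∣m⇒∣m*n (m / 2) m∣2ℓ))
  where
  m≡ : m ≡ m / 2 * 2 + 1
  m≡ = trans (m≡m%n+[m/n]*n m 2) (trans (cong (_+ m / 2 * 2) m-odd) (+-comm 1 (m / 2 * 2)))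
∣*stride⇒∣ m m-odd false ℓ m∣ = ∣m+n∣m⇒∣n
  (subst (m ∣_) (trans (cong (ℓ *_) (sym (m∸n+n≡m (>-nonZero⁻¹ m))))
    (trans (*-distribˡ-+ ℓ (m ∸ 1) 1) (cong (λ x → ℓ * (m ∸ 1) + x) (*-identityʳ ℓ)))) (n∣m*n ℓ)) m∣

-- Embeddings from labellings

-- `label` identifies the places with the elements outside J; the values of `place` on J are
-- arbitrary. The last two fields give 1 and 2 the same colour, which makes the relation 1 + 1 = 2
-- available for comparing local actions.
record Labelling (v t m : ℕ) .{{_ : NonZero v}} .{{_ : NonZero t}} .{{_ : NonZero m}} : Set where
  field
    label      : Place m → Fin v
    place      : Fin v → Place m
    place-label : ∀ p → place (label p) ≡ p
    label-place : ∀ z → ¬ (v / t ∣ toℕ z) → label (place z) ≡ z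
    label-∤    : ∀ p → ¬ (v / t ∣ toℕ (label p))
    label-opp  : ∀ p → label (opp p) ≡ ⊝ label p
    label-one  : label (true , 0 mod m) ≡ 1 mod v
    label-two  : label (true , 1 mod m) ≡ 1 mod v ⊕ 1 mod v

module _ {v t m : ℕ} .{{_ : NonZero v}} .{{_ : NonZero t}} .{{_ : NonZero m}} (t∣v : t ∣ v) where

  v/t∣v : v / t ∣ v
  v/t∣v = divides t (trans (sym (m/n*n≡m t∣v)) (*-comm (v / t) t))

  Γ : Graph v
  Γ = completeMultipartite v t

  edge-≡ : ∀ {x y y′ : Fin v} .{a : Adj Γ x y} .{a′ : Adj Γ x y′} → y ≡ y′ →
           _≡_ {A = OEdge Γ} (edge x y a) (edge x y′ a′)
  edge-≡ refl = refl

  difference-∤ : ∀ (e : OEdge Γ) → ¬ (v / t ∣ toℕ (tgt e ⊖ src e))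
  difference-∤ (edge x y a) d = ⊥-elim-irr (a (⊖-swap-∈ (v / t) y x (∣⇒∈⟨⟩ v/t∣v d)))

  module FromLabelling (L : Labelling v t m) where

    open Labelling L public
    open Endo (OEdge Γ) using (_^_)

    adjacent : ∀ x p → Adj Γ x (x ⊕ label p)
    adjacent x p d = label-∤ p (subst (λ z → v / t ∣ toℕ z) ([x⊕y]⊖x≡y x (label p))
      (∈⟨⟩⇒∣ v/t∣v (⊖-swap-∈ (v / t) x (x ⊕ label p) d)))

    -- Coordinates for oriented edges, with inverse `code`: the rotation acts as `next` on the
    -- place, and reversal moves to the other end and applies `opp`.
    dart : Fin v → Place m → OEdge Γ
    dart x p = edge x (x ⊕ label p) (adjacent x p)

    code : OEdge Γ → Place m
    code e = place (tgt e ⊖ src e)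

    code-dart : ∀ x p → code (dart x p) ≡ p
    code-dart x p = trans (cong place ([x⊕y]⊖x≡y x (label p))) (place-label p)

    dart-code : ∀ e → dart (src e) (code e) ≡ e
    dart-code e@(edge x y a) = edge-≡
      (trans (cong (x ⊕_) (label-place _ (difference-∤ e))) (x⊕[y⊖x]≡y x y))

    turnEdge : Bool → OEdge Γ → OEdge Γ
    turnEdge o e = dart (src e) (turn o (code e))

    turnEdge-dart : ∀ o x p → turnEdge o (dart x p) ≡ dart x (turn o p)
    turnEdge-dart o x p = cong (dart x ∘ turn o) (code-dart x p)

    reverse-dart : ∀ x p → reverse (dart x p) ≡ dart (x ⊕ label p) (opp p)
    reverse-dart x p = edge-≡ (sym (trans (cong (x ⊕ label p ⊕_) (label-opp p))
      (x⊕y⊝y≡x (label p) x)))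

    rotation : OEdge Γ ↔ OEdge Γ
    rotation = mk↔ₛ′ (turnEdge true) (turnEdge false)
      (λ e → trans (turnEdge-dart true _ _) (trans (cong (dart (src e)) (next-prev _)) (dart-code e)))
      (λ e → trans (turnEdge-dart false _ _) (trans (cong (dart (src e)) (prev-next _)) (dart-code e)))

    rotation-iterate : ∀ i e → let open Endo (Place m) renaming (_^_ to _^ᵖ_) in
      (turnEdge true ^ i) e ≡ dart (src e) ((next ^ᵖ i) (code e))
    rotation-iterate zero    e = sym (dart-code e)
    rotation-iterate (suc i) e =
      trans (cong (turnEdge true) (rotation-iterate i e)) (turnEdge-dart true _ _)

    -- Connectedness comes from the place `(true , 0 mod m)` alone: its label is 1, so repeated
    -- steps along it reach every vertex.
    path : ∀ x i → Star (Adj Γ) x (x ⊕ i mod v)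
    path x zero    = subst (Star (Adj Γ) x) (sym (⊕-identityʳ x)) Star.ε
    path x (suc i) = adjacent x (true , 0 mod m) Star.◅
      subst (Star (Adj Γ) _) (begin
        x ⊕ label (true , 0 mod m) ⊕ i mod v  ≡⟨ cong (λ z → x ⊕ z ⊕ i mod v) label-one ⟩
        x ⊕ 1 mod v ⊕ i mod v                 ≡⟨ ⊕-assoc x _ _ ⟩
        x ⊕ (1 mod v ⊕ i mod v)               ≡⟨ cong (x ⊕_) (mod-+ 1 i) ⟨
        x ⊕ suc i mod v                       ∎) (path (x ⊕ label (true , 0 mod m)) i)
      where open ≡-Reasoning

    embedding : Embedding Γ
    embedding = record
      { connected = λ x y → subst (Star (Adj Γ) x)
          (trans (cong (x ⊕_) (mod-toℕ (y ⊖ x))) (x⊕[y⊖x]≡y x y)) (path x (toℕ (y ⊖ x)))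
      ; ρ = rotation
      ; ρ-src = λ e → refl
      ; ρ-cyclic = cyclic }
      where
      cyclic : ∀ e e′ → src e ≡ src e′ → ∃[ i ] (turnEdge true ^ i) e ≡ e′
      cyclic e e′ refl with i , eq ← next-transitive (code e) (code e′) =
        i , trans (rotation-iterate i e) (trans (cong (dart (src e)) eq) (dart-code e′))

    open Embedding embedding using (trace; IsBiembedding; FaceLengthsMultipleOf; SameFace)

    trace-dart : ∀ x p → trace (dart x p) ≡ dart (x ⊕ label p) (next (opp p))
    trace-dart x p = trans (cong (turnEdge true) (reverse-dart x p)) (turnEdge-dart true _ _)

    code-trace : ∀ e → code (trace e) ≡ next (opp (code e))
    code-trace e = trans (cong (code ∘ trace) (sym (dart-code e)))
      (trans (cong code (trace-dart (src e) (code e))) (code-dart _ _))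

    -- A step along a face keeps the colour and moves the index by a fixed stride. Both the
    -- constancy of the colouring and the face lengths are read off from this.
    code-trace-iterate : ∀ i e →
      code ((trace ^ i) e) ≡ shift ((i * stride {m} (proj₁ (code e))) mod m) (code e)
    code-trace-iterate zero    e = cong (proj₁ (code e) ,_) (sym (⊕-identityʳ _))
    code-trace-iterate (suc i) e = begin
      code ((trace ^ suc i) e)                      ≡⟨ code-trace ((trace ^ i) e) ⟩
      next (opp (code ((trace ^ i) e)))             ≡⟨ cong (next ∘ opp) (code-trace-iterate i e) ⟩
      next (opp (shift ((i * s) mod m) (code e)))   ≡⟨ next-opp c (proj₂ (code e) ⊕ (i * s) mod m) ⟩
      shift (s mod m) (shift ((i * s) mod m) (code e))
        ≡⟨ cong (c ,_) (trans (⊕-assoc (proj₂ (code e)) ((i * s) mod m) (s mod m)) (cong (proj₂ (code e) ⊕_)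
             (trans (⊕-comm ((i * s) mod m) (s mod m)) (sym (mod-+ s (i * s)))))) ⟩
      shift ((suc i * s) mod m) (code e)            ∎
      where
      open ≡-Reasoning
      c = proj₁ (code e)
      s = stride {m} c

    isBiembedding : IsBiembedding
    isBiembedding = proj₁ ∘ code , constant , proper
      where
      constant : ∀ e e′ → SameFace e e′ → proj₁ (code e) ≡ proj₁ (code e′)
      constant e _ (i , refl) = sym (cong proj₁ (code-trace-iterate i e))
      proper : ∀ e → proj₁ (code e) ≢ proj₁ (code (reverse e))
      proper e eq = not-¬ refl (sym (begin
        not (proj₁ (code e))                                  ≡⟨ opp-colour (code e) ⟨
        proj₁ (opp (code e))                                  ≡⟨ cong proj₁ (code-dart _ _) ⟨
        proj₁ (code (dart (src e ⊕ label (code e)) (opp (code e)))) ≡⟨ cong (proj₁ ∘ code) (reverse-dart _ _) ⟨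
        proj₁ (code (reverse (dart (src e) (code e))))        ≡⟨ cong (proj₁ ∘ code ∘ reverse) (dart-code e) ⟩
        proj₁ (code (reverse e))                              ≡⟨ eq ⟨
        proj₁ (code e)                                        ∎))
        where open ≡-Reasoning

    -- When a face closes up, its place recurs, so `ℓ` times the stride vanishes modulo `m`; the
    -- stride is invertible.
    face-length : m % 2 ≡ 1 → FaceLengthsMultipleOf m
    face-length m-odd e ℓ (_ , closed , _) = ∣*stride⇒∣ m m-odd (proj₁ (code e)) ℓ
      (m%n≡0⇒n∣m _ m (trans (mod-≡⇒%-≡ (ℓ * s) 0 (⊕-cancelˡ j ((ℓ * s) mod m) (0 mod m) (begin
        j ⊕ (ℓ * s) mod m   ≡⟨ cong proj₂ (code-trace-iterate ℓ e) ⟨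
        proj₂ (code ((trace ^ ℓ) e)) ≡⟨ cong (proj₂ ∘ code) closed ⟩
        j                   ≡⟨ ⊕-identityʳ j ⟨
        j ⊕ 0 mod m         ∎))) (n∣m⇒m%n≡0 0 m (m ∣0))))
      where
      open ≡-Reasoning
      j = proj₂ (code e)
      s = stride {m} (proj₁ (code e))

    -- Labels depend only on differences, so a translation keeps the code of every dart and hence
    -- commutes with the rotation.
    translation : ∀ g → Σ[ α ∈ Isomorphism embedding embedding ]
      ∀ x → Isomorphism.onVertex α x ≡ x ⊕ g
    translation g = record
      { σ = σ
      ; compat = inj₁ (λ e → begin
          onEdge (turnEdge true e)                 ≡⟨ onEdge-dart _ _ ⟩
          dart (src e ⊕ g) (next (code e))         ≡⟨ turnEdge-dart true _ _ ⟨
          turnEdge true (dart (src e ⊕ g) (code e)) ≡⟨ cong (turnEdge true) (onEdge-dart _ _) ⟨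
          turnEdge true (onEdge (dart (src e) (code e))) ≡⟨ cong (turnEdge true ∘ onEdge) (dart-code e) ⟩
          turnEdge true (onEdge e)                 ∎) } , λ x → refl
      where
      open ≡-Reasoning
      σ : GraphIso Γ Γ
      σ = record
        { bij = mk↔ₛ′ (_⊕ g) (_⊕ ⊝ g) (x⊝y⊕y≡x g) (x⊕y⊝y≡x g)
        ; adj-iff = λ x y → mk⇔
            (subst (λ z → ¬ z ∈⟨ v / t ⟩) (sym ([x⊕z]⊖[y⊕z]≡x⊖y x y g)))
            (subst (λ z → ¬ z ∈⟨ v / t ⟩) ([x⊕z]⊖[y⊕z]≡x⊖y x y g)) }
      open GraphIso σ using (onEdge)
      onEdge-dart : ∀ x p → onEdge (dart x p) ≡ dart (x ⊕ g) p
      onEdge-dart x p = edge-≡ (⊕-swapʳ x (label p) g)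

-- Isomorphisms

module _ {v : ℕ} .{{_ : NonZero v}} where

  ·-distribˡ-⊕ : ∀ d (x y : Fin v) → d · (x ⊕ y) ≡ d · x ⊕ d · y
  ·-distribˡ-⊕ d x y = trans (mod-cong (begin
    (d * toℕ (x ⊕ y)) % v                  ≡⟨ cong (λ s → (d * s) % v) (toℕ-mod _) ⟩
    (d * ((toℕ x + toℕ y) % v)) % v        ≡⟨ %-distribˡ-* d _ v ⟩
    ((d % v) * ((toℕ x + toℕ y) % v % v)) % v ≡⟨ cong (λ s → ((d % v) * s) % v) (m%n%n≡m%n _ v) ⟩
    ((d % v) * ((toℕ x + toℕ y) % v)) % v  ≡⟨ %-distribˡ-* d _ v ⟨
    (d * (toℕ x + toℕ y)) % v              ≡⟨ cong (_% v) (*-distribˡ-+ d (toℕ x) (toℕ y)) ⟩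
    (d * toℕ x + d * toℕ y) % v            ∎)) (mod-+ (d * toℕ x) (d * toℕ y))
    where open ≡-Reasoning

  suc-· : ∀ d (x : Fin v) → suc d · x ≡ d · x ⊕ x
  suc-· d x = trans (cong (_mod v) (+-comm (toℕ x) (d * toℕ x)))
    (trans (mod-+ (d * toℕ x) (toℕ x)) (cong (d · x ⊕_) (mod-toℕ x)))

  ·-⊝ : ∀ d (x : Fin v) → d · (⊝ x) ≡ ⊝ (d · x)
  ·-⊝ d x = ⊝-uniqueˡ (d · (⊝ x)) (d · x) (begin
    d · (⊝ x) ⊕ d · x  ≡⟨ ·-distribˡ-⊕ d (⊝ x) x ⟨
    d · (⊝ x ⊕ x)      ≡⟨ cong (d ·_) (⊕-inverseˡ x) ⟩
    d · (0 mod v)      ≡⟨ cong (λ s → (d * s) mod v) (toℕ-mod-< (>-nonZero⁻¹ v)) ⟩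
    (d * 0) mod v      ≡⟨ cong (_mod v) (*-zeroʳ d) ⟩
    0 mod v            ∎)
    where open ≡-Reasoning

  toℕ-·-1 : ∀ (x : Fin v) → toℕ x · (1 mod v) ≡ x
  toℕ-·-1 x = trans (iterate (toℕ x)) (mod-toℕ x)
    where
    iterate : ∀ d → d · (1 mod v) ≡ d mod v
    iterate zero    = refl
    iterate (suc d) = trans (suc-· d (1 mod v)) (trans (cong (_⊕ 1 mod v) (iterate d)) (sym (mod-suc d)))

module _ {v t m : ℕ} .{{_ : NonZero v}} .{{_ : NonZero t}} .{{_ : NonZero m}} (t∣v : t ∣ v)
  (L L′ : Labelling v t m) where

  private
    module M  = FromLabelling t∣v L
    module M′ = FromLabelling t∣v L′

  label′-injective : ∀ {p q} → M′.label p ≡ M′.label q → p ≡ q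
  label′-injective {p} {q} eq =
    trans (sym (M′.place-label p)) (trans (cong M′.place eq) (M′.place-label q))

  module _ (α : Isomorphism M.embedding M′.embedding) where

    open Isomorphism α

    private
      s : Fin v → Fin v
      s = onVertex

    oriented : Σ[ o ∈ Bool ] ∀ e → onEdge (M.turnEdge true e) ≡ M′.turnEdge o (onEdge e)
    oriented with compat
    ... | inj₁ c = true  , c
    ... | inj₂ c = false , c

    o : Bool
    o = proj₁ oriented

    -- The action of the isomorphism on the places around `x`, with values in the places around the
    -- image of `x`.
    local : Fin v → Place m → Place m
    local x p = M′.code (onEdge (M.dart x p))

    onEdge-dart : ∀ x p → onEdge (M.dart x p) ≡ M′.dart (s x) (local x p)
    onEdge-dart x p = sym (M′.dart-code (onEdge (M.dart x p)))

    onVertex-⊕ : ∀ x p → s (x ⊕ M.label p) ≡ s x ⊕ M′.label (local x p)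
    onVertex-⊕ x p = cong tgt (onEdge-dart x p)

    local-intertwines : ∀ x → Intertwines o (local x)
    local-intertwines x p = begin
      M′.code (onEdge (M.dart x (next p)))          ≡⟨ cong (M′.code ∘ onEdge) (M.turnEdge-dart true x p) ⟨
      M′.code (onEdge (M.turnEdge true (M.dart x p))) ≡⟨ cong M′.code (proj₂ oriented (M.dart x p)) ⟩
      M′.code (M′.turnEdge o (onEdge (M.dart x p))) ≡⟨ M′.code-dart _ _ ⟩
      turn o (local x p)                            ∎
      where open ≡-Reasoning

    -- An isomorphism commutes with reversal, which links the local actions at the two ends of an
    -- edge.
    local-opp : ∀ x p → local (x ⊕ M.label p) (opp p) ≡ opp (local x p)
    local-opp x p = begin
      M′.code (onEdge (M.dart (x ⊕ M.label p) (opp p)))  ≡⟨ cong (M′.code ∘ onEdge) (M.reverse-dart x p) ⟨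
      M′.code (reverse (onEdge (M.dart x p)))            ≡⟨ cong (M′.code ∘ reverse) (onEdge-dart x p) ⟩
      M′.code (reverse (M′.dart (s x) (local x p)))      ≡⟨ cong M′.code (M′.reverse-dart (s x) (local x p)) ⟩
      M′.code (M′.dart (s x ⊕ M′.label (local x p)) (opp (local x p))) ≡⟨ M′.code-dart _ _ ⟩
      opp (local x p)                                    ∎
      where open ≡-Reasoning

    origin : Place m
    origin = true , 0 mod m

    defect : Fin v → Fin m
    defect x = twist o (proj₁ (local x origin))

    -- Both sides are intertwiners, so agreement at one place suffices. At `opp (true , j)` the left
    -- side sees the reversed edge from its other end and yields `opp` of the local image; the
    -- action at `x` differs from that by the shift `defect x`, which is undone.
    local-step : ∀ x j p → local (x ⊕ M.label (true , j)) p ≡ shift (⊝ defect x) (local x p)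
    local-step x j = intertwiner-determined o {A = local (x ⊕ M.label (true , j))}
      {B = shift (⊝ defect x) ∘ local x}
      (local-intertwines _)
      (λ p → trans (cong (shift (⊝ defect x)) (local-intertwines x p)) (sym (turn-shift o _ _)))
      (opp (true , j)) (begin
        local (x ⊕ M.label (true , j)) (opp (true , j))  ≡⟨ local-opp x (true , j) ⟩
        opp (local x (true , j))                         ≡⟨ cong (proj₁ (opp (local x (true , j))) ,_) (x⊕y⊝y≡x (defect x) _) ⟨
        shift (⊝ defect x) (shift (defect x) (opp (local x (true , j))))
          -- The defect is defined at `origin`; it is the same at every place of colour true because
          -- their images share a colour.
          ≡⟨ cong (λ c → shift (⊝ defect x) (shift (twist o c) (opp (local x (true , j)))))
               (intertwiner-colour o {A = local x} (local-intertwines x) (0 mod m) j) ⟩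
        shift (⊝ defect x) (shift (twist o (proj₁ (local x (true , j)))) (opp (local x (true , j))))
          ≡⟨ cong (shift (⊝ defect x)) (intertwiner-opp o {A = local x} (local-intertwines x) j) ⟨
        shift (⊝ defect x) (local x (opp (true , j)))    ∎)
      where open ≡-Reasoning

    -- The labels 1 and 2 both have colour true, so the identity 1 + 1 = 2
    -- makes two steps and one step produce the same shift.
    defect≡0 : ∀ x → ⊝ defect x ≡ 0 mod m
    defect≡0 x = ⊕-cancelˡ (proj₂ (local x origin) ⊕ ⊝ defect x) _ _ (begin
      j ⊕ ⊝ defect x ⊕ ⊝ defect x
        ≡⟨ cong (λ c → j ⊕ ⊝ defect x ⊕ ⊝ twist o c) (cong proj₁ (local-step x (0 mod m) origin)) ⟨
      j ⊕ ⊝ defect x ⊕ ⊝ defect (x ⊕ M.label origin)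
        ≡⟨ cong (_⊕ ⊝ defect (x ⊕ M.label origin)) (cong proj₂ (local-step x (0 mod m) origin)) ⟨
      proj₂ (local (x ⊕ M.label origin) origin) ⊕ ⊝ defect (x ⊕ M.label origin)
        ≡⟨ cong proj₂ (local-step (x ⊕ M.label origin) (0 mod m) origin) ⟨
      proj₂ (local (x ⊕ M.label origin ⊕ M.label origin) origin)
        ≡⟨ cong (λ y → proj₂ (local y origin)) (begin
             x ⊕ M.label origin ⊕ M.label origin  ≡⟨ cong (λ z → x ⊕ z ⊕ z) M.label-one ⟩
             x ⊕ 1 mod v ⊕ 1 mod v                ≡⟨ ⊕-assoc x _ _ ⟩
             x ⊕ (1 mod v ⊕ 1 mod v)              ≡⟨ cong (x ⊕_) M.label-two ⟨
             x ⊕ M.label (true , 1 mod m)         ∎) ⟩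
      proj₂ (local (x ⊕ M.label (true , 1 mod m)) origin)
        ≡⟨ cong proj₂ (local-step x (1 mod m) origin) ⟩
      j ⊕ ⊝ defect x
        ≡⟨ ⊕-identityʳ _ ⟨
      j ⊕ ⊝ defect x ⊕ 0 mod m ∎)
      where
      open ≡-Reasoning
      j = proj₂ (local x origin)

    zero-vertex : Fin v
    zero-vertex = 0 mod v

    local₀ : Place m → Place m
    local₀ = local zero-vertex

    local-suc : ∀ x p → local (x ⊕ 1 mod v) p ≡ local x p
    local-suc x p = begin
      local (x ⊕ 1 mod v) p            ≡⟨ cong (λ z → local (x ⊕ z) p) M.label-one ⟨
      local (x ⊕ M.label origin) p     ≡⟨ local-step x (0 mod m) p ⟩
      shift (⊝ defect x) (local x p)   ≡⟨ cong (proj₁ (local x p) ,_)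
        (trans (cong (proj₂ (local x p) ⊕_) (defect≡0 x)) (⊕-identityʳ _)) ⟩
      local x p                        ∎
      where open ≡-Reasoning

    local-constant : ∀ i p → local (i mod v) p ≡ local₀ p
    local-constant zero    p = refl
    local-constant (suc i) p = trans (cong (λ x → local x p) (mod-suc i))
      (trans (local-suc (i mod v) p) (local-constant i p))

    -- The image of the difference 1, which is the label at `origin`.
    multiplier : Fin v
    multiplier = M′.label (local₀ origin)

    onVertex-affine : ∀ i → s (i mod v) ≡ s zero-vertex ⊕ i · multiplier
    onVertex-affine zero    = sym (⊕-identityʳ _)
    onVertex-affine (suc i) = begin
      s (suc i mod v)                                      ≡⟨ cong s (mod-suc i) ⟩
      s (i mod v ⊕ 1 mod v)                                ≡⟨ cong (λ z → s (i mod v ⊕ z)) M.label-one ⟨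
      s (i mod v ⊕ M.label origin)                         ≡⟨ onVertex-⊕ (i mod v) origin ⟩
      s (i mod v) ⊕ M′.label (local (i mod v) origin)      ≡⟨ cong₂ (λ y p → y ⊕ M′.label p) (onVertex-affine i) (local-constant i origin) ⟩
      s zero-vertex ⊕ i · multiplier ⊕ multiplier          ≡⟨ ⊕-assoc _ _ _ ⟩
      s zero-vertex ⊕ (i · multiplier ⊕ multiplier)        ≡⟨ cong (s zero-vertex ⊕_) (suc-· i multiplier) ⟨
      s zero-vertex ⊕ suc i · multiplier                   ∎
      where open ≡-Reasoning

    -- The neighbour `label p` of 0 is mapped both through the local action at 0 and through the
    -- affine formula; comparing the two shows that the multiplier carries labels to labels.
    label-local₀ : ∀ p → M′.label (local₀ p) ≡ toℕ (M.label p) · multiplier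
    label-local₀ p = ⊕-cancelˡ (s zero-vertex) _ _ (begin
      s zero-vertex ⊕ M′.label (local₀ p)        ≡⟨ onVertex-⊕ zero-vertex p ⟨
      s (zero-vertex ⊕ M.label p)                ≡⟨ cong s (⊕-identityˡ (M.label p)) ⟩
      s (M.label p)                              ≡⟨ cong s (mod-toℕ (M.label p)) ⟨
      s (toℕ (M.label p) mod v)                  ≡⟨ onVertex-affine (toℕ (M.label p)) ⟩
      s zero-vertex ⊕ toℕ (M.label p) · multiplier ∎)
      where open ≡-Reasoning

  -- The condition concerns labels of colour true on both sides; for a colour-reversing isomorphism
  -- it is applied to the negated multiplier.
  Rigid : Set
  Rigid = ∀ u → (∀ j → Σ[ j′ ∈ Fin m ] M′.label (true , j′) ≡ toℕ (M.label (true , j)) · u) →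
          u ≡ 1 mod v

  module _ (3<m : 3 < m) (rigid : Rigid) where

    k-mod-m≢0 : ∀ k → 0 < k → k < m → k mod m ≢ 0 mod m
    k-mod-m≢0 k 0<k k<m eq = >⇒≢ 0<k (trans (sym (toℕ-mod-< k<m))
      (trans (cong toℕ eq) (toℕ-mod-< (<-trans 0<k k<m))))

    𝟛≢0 : 𝟛 {m} ≢ 0 mod m
    𝟛≢0 eq = k-mod-m≢0 3 (s≤s z≤n) 3<m (trans (trans (mod-+ 2 1) (cong (_⊕ 1 mod m) (mod-+ 1 1))) eq)

    ⊝-zero : ∀ (k : Fin m) → ⊝ k ≡ 0 mod m → k ≡ 0 mod m
    ⊝-zero k eq = trans (sym (⊕-identityʳ k)) (trans (cong (k ⊕_) (sym eq)) (⊕-inverseʳ k))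

    -- As `m` exceeds 3, a twist by 3 or -3 is nonzero. A vanishing defect therefore makes an
    -- isomorphism keep the colours if it keeps the orientation, and exchange them if it reverses
    -- the orientation.
    twist≡0⇒colour : ∀ o c → ⊝ twist {m} o c ≡ 0 mod m → c ≡ o
    twist≡0⇒colour true  true  _  = refl
    twist≡0⇒colour true  false eq = ⊥-elim (𝟛≢0 (⊝-zero _ eq))
    twist≡0⇒colour false true  eq = ⊥-elim (𝟛≢0 (trans (sym (⊝-involutive 𝟛)) eq))
    twist≡0⇒colour false false _  = refl

    isomorphism⇒≗ : (α : Isomorphism M.embedding M′.embedding) →
      (∀ p → M.label p ≡ M′.label p) ×
      (∀ x → Isomorphism.onVertex α x ≡ x ⊕ Isomorphism.onVertex α (0 mod v))
    isomorphism⇒≗ α = by-orientation (o α) (local-intertwines α (0 mod v)) (λ j →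
        trans (intertwiner-colour (o α) {A = local₀ α} (local-intertwines α _) j (0 mod m))
              (twist≡0⇒colour (o α) _ (defect≡0 α (0 mod v))))
      where
      A = local₀ α
      c = multiplier α
      open ≡-Reasoning
      by-orientation : ∀ o → Intertwines o A → (∀ j → proj₁ (A (true , j)) ≡ o) →
        (∀ p → M.label p ≡ M′.label p) ×
        (∀ x → Isomorphism.onVertex α x ≡ x ⊕ Isomorphism.onVertex α (0 mod v))
      by-orientation true A-int colour = labels , translates
        where
        c≡1 : c ≡ 1 mod v
        c≡1 = rigid c (λ j → proj₂ (A (true , j)) ,
          trans (cong (λ b → M′.label (b , proj₂ (A (true , j)))) (sym (colour j)))
                (label-local₀ α (true , j)))
        label-A : ∀ p → M′.label (A p) ≡ M.label p
        label-A p = trans (label-local₀ α p) (trans (cong (toℕ (M.label p) ·_) c≡1) (toℕ-·-1 _))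
        -- Both labellings have 1 at `(true , 0 mod m)`, so `A` agrees with the identity there and
        -- hence everywhere.
        A-id : ∀ p → A p ≡ p
        A-id = intertwiner-determined true {A = A} {B = λ p → p} A-int (λ _ → refl) (true , 0 mod m)
          (label′-injective (trans (label-A _) (trans M.label-one (sym M′.label-one))))
        labels : ∀ p → M.label p ≡ M′.label p
        labels p = trans (sym (label-A p)) (cong M′.label (A-id p))
        translates : ∀ x → Isomorphism.onVertex α x ≡ x ⊕ Isomorphism.onVertex α (0 mod v)
        translates x = trans (cong (Isomorphism.onVertex α) (sym (mod-toℕ x)))
          (trans (onVertex-affine α (toℕ x))
          (trans (cong (Isomorphism.onVertex α (0 mod v) ⊕_)
             (trans (cong (toℕ x ·_) c≡1) (toℕ-·-1 x))) (⊕-comm _ x)))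
      -- A reversing isomorphism has multiplier -1 and acts as `opp` on the places of 1 and 2. Two
      -- `next` steps lead from the first to the second, so the image of the second is two steps
      -- back and has index 0, whereas `opp` gives it index 2.
      by-orientation false A-int colour = ⊥-elim (k-mod-m≢0 2 (s≤s z≤n) (<-trans (s≤s (s≤s (s≤s z≤n))) 3<m) (begin
          2 mod m                    ≡⟨ mod-+ 1 1 ⟩
          𝟙 ⊕ 𝟙                      ≡⟨ cong proj₂ (A-fixed (true , 1 mod m) (trans M.label-two (sym M′.label-two))) ⟨
          proj₂ (A (true , 1 mod m)) ≡⟨ cong (proj₂ ∘ A ∘ (true ,_)) (⊕-identityˡ 𝟙) ⟨
          proj₂ (A (next (next (true , 0 mod m))))  ≡⟨ cong proj₂ (trans (A-int _) (cong prev (A-int _))) ⟩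
          proj₂ (prev (prev (A (true , 0 mod m))))
            ≡⟨ cong (proj₂ ∘ prev ∘ prev) (A-fixed (true , 0 mod m) (trans M.label-one (sym M′.label-one))) ⟩
          0 mod m ⊕ 𝟙 ⊕ ⊝ 𝟙          ≡⟨ x⊕y⊝y≡x 𝟙 (0 mod m) ⟩
          0 mod m                    ∎))
        where
        label-opp-A : ∀ p → M′.label (opp (A p)) ≡ toℕ (M.label p) · (⊝ c)
        label-opp-A p = trans (M′.label-opp (A p))
          (trans (cong ⊝_ (label-local₀ α p)) (sym (·-⊝ (toℕ (M.label p)) c)))
        ⊝c≡1 : ⊝ c ≡ 1 mod v
        ⊝c≡1 = rigid (⊝ c) (λ j → proj₂ (opp (A (true , j))) ,
          trans (cong (λ b → M′.label (b , proj₂ (opp (A (true , j)))))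
            (sym (trans (opp-colour (A (true , j))) (cong not (colour j)))))
            (label-opp-A (true , j)))
        A-fixed : ∀ p → M.label p ≡ M′.label p → A p ≡ opp p
        A-fixed p eq = trans (sym (opp-involutive (A p))) (cong opp (label′-injective (begin
          M′.label (opp (A p))               ≡⟨ label-opp-A p ⟩
          toℕ (M.label p) · (⊝ c)            ≡⟨ cong (toℕ (M.label p) ·_) ⊝c≡1 ⟩
          toℕ (M.label p) · (1 mod v)        ≡⟨ toℕ-·-1 (M.label p) ⟩
          M.label p                          ≡⟨ eq ⟩
          M′.label p                         ∎)))

-- Multipliers

multiple-above : ∀ a u .{{_ : NonZero u}} → Σ[ i ∈ ℕ ] (i * u ≤ a × a < suc i * u)
multiple-above a u = a / u , m/n*n≤m a u , (begin-strict
  a                      ≡⟨ m≡m%n+[m/n]*n a u ⟩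
  a % u + a / u * u      <⟨ +-monoˡ-< (a / u * u) (m%n<n a u) ⟩
  u + a / u * u          ∎)
  where open ≤-Reasoning

module _ {v w t R z u : ℕ} .{{_ : NonZero v}}
  (v≡ : v ≡ R + R + z) (v≡tw : v ≡ t * w) (t≤z : t ≤ z)
  (3≤z : 3 ≤ z) (z²≤R : z * z ≤ R) (2z+2≤w : z + z + 2 ≤ w) (u<v : u < v)
  (confined : ∀ p → 0 < p → p ≤ R → ¬ w ∣ p → (p * u) % v ≢ 0 × (p * u) % v < R + z) where

  private
    3z≤R : 3 * z ≤ R
    3z≤R = ≤-trans (*-monoˡ-≤ z 3≤z) z²≤R

    z≤R : z ≤ R
    z≤R = ≤-trans (m≤m+n z (2 * z)) 3z≤R

    2z≤R : z + z ≤ R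
    2z≤R = ≤-trans (+-monoʳ-≤ z (m≤m+n z (1 * z))) 3z≤R

    escape : ∀ p a r → p * u ≡ r + a * v → R + z ≤ r → r < v →
             0 < p → p ≤ R → ¬ w ∣ p → ⊥
    escape p a r eq above r<v 0<p p≤R w∤p = <⇒≱ (proj₂ (confined p 0<p p≤R w∤p))
      (subst (R + z ≤_) (sym (begin
        (p * u) % v      ≡⟨ cong (_% v) eq ⟩
        (r + a * v) % v  ≡⟨ [m+kn]%n≡m%n r a v ⟩
        r % v            ≡⟨ m<n⇒m%n≡m r<v ⟩
        r                ∎)) above)
      where open ≡-Reasoning

    small∤ : ∀ {p} → 0 < p → p ≤ z + z + 1 → ¬ w ∣ p
    small∤ {p} 0<p p≤ w∣p = <⇒≱
      (≤-<-trans p≤ (<-≤-trans (+-monoʳ-< (z + z) (n<1+n 1)) 2z+2≤w)) (∣⇒≤ {{>-nonZero 0<p}} w∣p)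

    1≤2z+1 : 1 ≤ z + z + 1
    1≤2z+1 = m≤n+m 1 (z + z)

    2≤2z+1 : 2 ≤ z + z + 1
    2≤2z+1 = +-mono-≤ {1} (≤-trans (s≤s z≤n) (≤-trans 3≤z (m≤m+n z z))) ≤-refl

    2z+1≤R : z + z + 1 ≤ R
    2z+1≤R = ≤-trans (+-monoʳ-≤ (z + z) (≤-trans (s≤s z≤n) 3≤z)) (subst (_≤ R) (lemma z) 3z≤R)
      where
      lemma : ∀ z → 3 * z ≡ z + z + z
      lemma = solve-∀

    u≢0 : u ≢ 0
    u≢0 refl = proj₁ (confined 1 ≤-refl (≤-trans 1≤2z+1 2z+1≤R) (small∤ ≤-refl 1≤2z+1))
      (n∣m⇒m%n≡0 0 v (v ∣0))

    u<R+z : u < R + z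
    u<R+z = subst (_< R + z)
      (trans (cong (_% v) (*-identityˡ u)) (m<n⇒m%n≡m u<v))
      (proj₂ (confined 1 ≤-refl (≤-trans 1≤2z+1 2z+1≤R) (small∤ ≤-refl 1≤2z+1)))

    -- The window from `R + z` up to `v` has length `R`, which is at least `u`, so the first
    -- multiple of `u` not below `R + z` falls into it.
    low : 2 ≤ u → u ≤ R → ⊥
    low 2≤u u≤R with multiple-above (pred (R + z)) u {{≢-nonZero u≢0}}
    ... | i , iu≤ , above = step
      where
      j = suc i
      suc-pred≡ : suc (pred (R + z)) ≡ R + z
      suc-pred≡ = suc-pred (R + z) {{>-nonZero (≤-trans (≤-trans (s≤s z≤n) 3≤z) (m≤n+m z R))}}
      R+z≤ju : R + z ≤ j * u
      R+z≤ju = subst (_≤ j * u) suc-pred≡ above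
      iu< : i * u < R + z
      iu< = subst (i * u <_) suc-pred≡ (s≤s iu≤)
      ju< : j * u < u + (R + z)
      ju< = +-monoʳ-< u iu<
      ju<v : j * u < v
      ju<v = <-≤-trans ju< (subst (u + (R + z) ≤_) (trans (sym (+-assoc R R z)) (sym v≡)) (+-monoˡ-≤ (R + z) u≤R))
      i<R : i < R
      i<R = ≰⇒> λ R≤i → <⇒≱ iu< (begin
        R + z        ≤⟨ +-monoʳ-≤ R z≤R ⟩
        R + R        ≡⟨ cong (λ y → R + y) (+-identityʳ R) ⟨
        2 * R        ≤⟨ *-mono-≤ 2≤u R≤i ⟩
        u * i        ≡⟨ *-comm u i ⟩
        i * u        ∎)
        where open ≤-Reasoning
      step : ⊥
      step with w ∣? j
      ... | no  w∤j = escape j 0 (j * u) (sym (+-identityʳ (j * u))) R+z≤ju ju<v (s≤s z≤n) i<R w∤j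
      -- If `w` divides `j`, then `w ≤ j` makes `u` smaller than `t`, and with so small a `u` the
      -- following multiple is still in the window.
      ... | yes w∣j = escape (suc j) 0 (suc j * u) (sym (+-identityʳ _))
              (≤-trans R+z≤ju (m≤n+m (j * u) u)) sju<v (s≤s z≤n) j<R w∤sj
        where
        open ≤-Reasoning
        u<t : u < t
        u<t = *-cancelʳ-< w u t (begin-strict
          u * w   ≤⟨ *-monoʳ-≤ u (∣⇒≤ w∣j) ⟩
          u * j   ≡⟨ *-comm u j ⟩
          j * u   <⟨ ju<v ⟩
          v       ≡⟨ v≡tw ⟩
          t * w   ∎)
        u≤z : u ≤ z
        u≤z = ≤-trans (<⇒≤ u<t) t≤z
        sju<v : suc j * u < v
        sju<v = begin-strict
          u + j * u        <⟨ +-monoʳ-< u ju< ⟩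
          u + (u + (R + z)) ≡⟨ +-assoc u u (R + z) ⟨
          u + u + (R + z)  ≤⟨ +-monoˡ-≤ (R + z) (≤-trans (+-mono-≤ u≤z u≤z) 2z≤R) ⟩
          R + (R + z)      ≡⟨ trans (sym (+-assoc R R z)) (sym v≡) ⟩
          v                ∎
        j<R : j < R
        j<R = ≰⇒> λ R≤j → <⇒≱ ju< (begin
          u + (R + z)     ≤⟨ +-monoˡ-≤ (R + z) u≤z ⟩
          z + (R + z)     ≡⟨ rearrange z R ⟩
          R + (z + z)     ≤⟨ +-monoʳ-≤ R 2z≤R ⟩
          R + R           ≡⟨ cong (λ y → R + y) (+-identityʳ R) ⟨
          2 * R           ≤⟨ *-mono-≤ 2≤u R≤j ⟩
          u * j           ≡⟨ *-comm u j ⟩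
          j * u           ∎)
          where
          rearrange : ∀ z R → z + (R + z) ≡ R + (z + z)
          rearrange = solve-∀
        w∤sj : ¬ w ∣ suc j
        w∤sj d = small∤ ≤-refl 1≤2z+1 (∣m+n∣m⇒∣n (subst (w ∣_) (+-comm 1 j) d) w∣j)

    -- Here `u` is near `v / 2`. If `2 * u` is below `v` it lies in the window, and at `v` it
    -- vanishes modulo `v`; above `v` its small excess has to be amplified.
    high : R < u → ⊥
    high R<u with <-cmp (2 * u) v
    ... | tri< 2u<v _ _ = escape 2 0 (2 * u) (sym (+-identityʳ _))
            (begin
              R + z        ≤⟨ +-mono-≤ (<⇒≤ R<u) (≤-trans z≤R (<⇒≤ R<u)) ⟩
              u + u        ≡⟨ cong (λ y → u + y) (+-identityʳ u) ⟨
              2 * u        ∎) 2u<v (s≤s z≤n) (≤-trans 2≤2z+1 2z+1≤R) (small∤ (s≤s z≤n) 2≤2z+1)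
      where open ≤-Reasoning
    ... | tri≈ _ 2u≡v _ = proj₁ (confined 2 (s≤s z≤n) (≤-trans 2≤2z+1 2z+1≤R) (small∤ (s≤s z≤n) 2≤2z+1))
            (trans (cong (_% v) 2u≡v) (n%n≡0 v))
    -- Modulo `v` the multiple `(z + z + 1) * u` is `z * d + u`, where `d` is the excess of `2 * u`
    -- over `v`. From `1 ≤ d` it is at least `R + z`, and from `d < z` and `z * z ≤ R` it stays
    -- below `v`.
    ... | tri> _ _ v<2u = escape (z + z + 1) z (z * d + u)
            (trans (expand z u) (trans (cong (λ x → z * x + u) 2u≡) (regroup z d v u)))
            (begin
              R + z        ≡⟨ +-comm R z ⟩
              z + R        ≤⟨ +-mono-≤ (subst (_≤ z * d) (*-identityʳ z) (*-monoʳ-≤ z 1≤d)) (<⇒≤ R<u) ⟩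
              z * d + u    ∎)
            (begin-strict
              z * d + u        <⟨ +-monoʳ-< (z * d) u<R+z ⟩
              z * d + (R + z)  ≡⟨ collect z d R ⟩
              R + z * suc d    ≤⟨ +-monoʳ-≤ R (≤-trans (*-monoʳ-≤ z d<z) z²≤R) ⟩
              R + R            ≤⟨ m≤m+n (R + R) z ⟩
              R + R + z        ≡⟨ v≡ ⟨
              v                ∎)
            1≤2z+1 2z+1≤R (small∤ 1≤2z+1 ≤-refl)
      where
      open ≤-Reasoning
      d = 2 * u ∸ v
      2u≡ : 2 * u ≡ d + v
      2u≡ = sym (m∸n+n≡m (<⇒≤ v<2u))
      1≤d : 1 ≤ d
      1≤d = m<n⇒0<n∸m v<2u
      expand : ∀ z u → (z + z + 1) * u ≡ z * (2 * u) + u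
      expand = solve-∀
      regroup : ∀ z d v u → z * (d + v) + u ≡ z * d + u + z * v
      regroup = solve-∀
      collect : ∀ z d R → z * d + (R + z) ≡ R + z * suc d
      collect = solve-∀
      d<z : d < z
      d<z = +-cancelʳ-< v d z (begin-strict
        d + v              ≡⟨ 2u≡ ⟨
        2 * u              ≡⟨ cong (λ y → u + y) (+-identityʳ u) ⟩
        u + u              <⟨ +-mono-< u<R+z u<R+z ⟩
        R + z + (R + z)    ≡⟨ rearrange R z ⟩
        z + (R + R + z)    ≡⟨ cong (λ y → z + y) v≡ ⟨
        z + v              ∎)
        where
        rearrange : ∀ R z → R + z + (R + z) ≡ z + (R + R + z)
        rearrange = solve-∀

  multiplier≡1 : u ≡ 1
  multiplier≡1 = ≤-antisym (≮⇒≥ 2≰u) (n≢0⇒n>0 u≢0)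
    where
    2≰u : ¬ 2 ≤ u
    2≰u 2≤u with u ≤? R
    ... | yes u≤R = low 2≤u u≤R
    ... | no  u≰R = high (≰⇒> u≰R)

-- Half-sets

[m+k*n]/n≡k : ∀ {m n} .{{_ : NonZero n}} k → m < n → (m + k * n) / n ≡ k
[m+k*n]/n≡k {m} {n} k m<n = trans (+-distrib-/-∣ʳ m (n∣m*n k))
  (cong₂ _+_ (m<n⇒m/n≡0 m<n) (m*n/n≡m k n))

-- unrank lists the positive integers not divisible by suc w′ in increasing order.
module _ (w′ : ℕ) .{{_ : NonZero w′}} where

  unrank rank : ℕ → ℕ
  unrank i = suc (i + i / w′)
  rank x = pred x ∸ x / suc w′

  -- Each block of `suc w′` consecutive integers has `w′` non-multiples. In terms of the block `a`
  -- and the offset `r` both functions are affine, so later proofs first split an index or an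
  -- element this way.
  unrank-split : ∀ {r} a → r < w′ → unrank (r + a * w′) ≡ suc r + a * suc w′
  unrank-split {r} a r<w′ = cong suc (begin
    r + a * w′ + (r + a * w′) / w′  ≡⟨ cong (λ x → r + a * w′ + x) ([m+k*n]/n≡k a r<w′) ⟩
    r + a * w′ + a                  ≡⟨ regroup r a w′ ⟩
    r + a * suc w′                  ∎)
    where
    open ≡-Reasoning
    regroup : ∀ r a w → r + a * w + a ≡ r + a * suc w
    regroup = solve-∀

  rank-split : ∀ {r} a → r < w′ → rank (suc r + a * suc w′) ≡ r + a * w′
  rank-split {r} a r<w′ = begin
    r + a * suc w′ ∸ (suc r + a * suc w′) / suc w′  ≡⟨ cong (r + a * suc w′ ∸_) ([m+k*n]/n≡k a (s≤s r<w′)) ⟩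
    r + a * suc w′ ∸ a                              ≡⟨ cong (_∸ a) (regroup r a w′) ⟩
    r + a * w′ + a ∸ a                              ≡⟨ m+n∸n≡m (r + a * w′) a ⟩
    r + a * w′                                      ∎
    where
    open ≡-Reasoning
    regroup : ∀ r a w → r + a * suc w ≡ r + a * w + a
    regroup = solve-∀

  rank< : ∀ x → 0 < x → rank x < x
  rank< (suc x) _ = s≤s (m∸n≤m x (suc x / suc w′))

  split-index : ∀ i → Σ[ r ∈ ℕ ] Σ[ a ∈ ℕ ] (r < w′ × i ≡ r + a * w′)
  split-index i = i % w′ , i / w′ , m%n<n i w′ , m≡m%n+[m/n]*n i w′

  split-element : ∀ x → ¬ suc w′ ∣ x → Σ[ r ∈ ℕ ] Σ[ a ∈ ℕ ] (r < w′ × x ≡ suc r + a * suc w′)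
  split-element x w∤x with x % suc w′ in eq
  ... | zero  = ⊥-elim (w∤x (m%n≡0⇒n∣m x (suc w′) eq))
  ... | suc r = r , x / suc w′ , s≤s⁻¹ (subst (_< suc w′) eq (m%n<n x (suc w′))) ,
    trans (m≡m%n+[m/n]*n x (suc w′)) (cong (_+ x / suc w′ * suc w′) eq)

  rank-unrank : ∀ i → rank (unrank i) ≡ i
  rank-unrank i with r , a , r<w′ , refl ← split-index i =
    trans (cong rank (unrank-split a r<w′)) (rank-split a r<w′)

  unrank-rank : ∀ x → ¬ suc w′ ∣ x → unrank (rank x) ≡ x
  unrank-rank x w∤x with r , a , r<w′ , refl ← split-element x w∤x =
    trans (cong unrank (rank-split a r<w′)) (unrank-split a r<w′)

  unrank-∤ : ∀ i → ¬ suc w′ ∣ unrank i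
  unrank-∤ i w∣ with r , a , r<w′ , refl ← split-index i =
    >⇒∤ (s≤s r<w′) (∣m+n∣m⇒∣n
      (subst (suc w′ ∣_) (trans (unrank-split a r<w′) (+-comm (suc r) (a * suc w′))) w∣) (n∣m*n a))

  module _ {t m : ℕ} (2m≡ : m + m ≡ t * w′) where

    -- Doubling the element gives twice `suc i`, at most `m + m`, plus twice its block number, which
    -- is below `t`; and `m + m + t` equals `t * suc w′`.
    unrank-half : ∀ i → i < m → unrank i + unrank i < t * suc w′
    unrank-half i i<m with r , a , r<w′ , refl ← split-index i =
      subst (λ y → y + y < t * suc w′) (sym (unrank-split a r<w′)) (begin-strict
        suc r + a * suc w′ + (suc r + a * suc w′)   ≡⟨ regroup r a w′ ⟩
        suc (r + a * w′) + suc (r + a * w′) + (a + a) <⟨ +-monoʳ-< _ 2a<t ⟩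
        suc (r + a * w′) + suc (r + a * w′) + t     ≤⟨ +-monoˡ-≤ t (+-mono-≤ i<m i<m) ⟩
        m + m + t                                   ≡⟨ cong (_+ t) 2m≡ ⟩
        t * w′ + t                                  ≡⟨ trans (+-comm (t * w′) t) (sym (*-suc t w′)) ⟩
        t * suc w′                                  ∎)
      where
      open ≤-Reasoning
      regroup : ∀ r a w → suc r + a * suc w + (suc r + a * suc w) ≡
                          suc (r + a * w) + suc (r + a * w) + (a + a)
      regroup = solve-∀
      2a<t : a + a < t
      2a<t = *-cancelʳ-< w′ _ t (begin-strict
        (a + a) * w′                   ≡⟨ *-distribʳ-+ w′ a a ⟩
        a * w′ + a * w′                ≤⟨ +-mono-≤ (m≤n+m _ r) (m≤n+m _ r) ⟩
        r + a * w′ + (r + a * w′)      <⟨ +-mono-< i<m i<m ⟩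
        m + m                          ≡⟨ 2m≡ ⟩
        t * w′                         ∎)

    half-rank : ∀ x → ¬ suc w′ ∣ x → x + x < t * suc w′ → rank x < m
    half-rank x w∤x 2x< with r , a , r<w′ , refl ← split-element x w∤x =
      subst (_< m) (sym (rank-split a r<w′)) (≰⇒> λ m≤ → <⇒≱ double< (+-mono-≤ m≤ m≤))
      where
      open ≤-Reasoning
      regroup₁ : ∀ r a w → r + a * w + (r + a * w) ≡ r + r + (a + a) * w
      regroup₁ = solve-∀
      regroup₂ : ∀ r a w → suc r + a * suc w + (suc r + a * suc w) ≡
                           suc (suc (r + r)) + (a + a) * suc w
      regroup₂ = solve-∀
      double< : r + a * w′ + (r + a * w′) < m + m
      -- Half of `t * suc w′` lies at or before the start of block `a`, cuts the block in the
      -- middle, or lies beyond it.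
      double< with <-cmp t (suc (a + a))
      ... | tri< t≤2a _ _ = ⊥-elim (<⇒≱ 2x< (begin
              t * suc w′                      ≤⟨ *-monoˡ-≤ (suc w′) (s≤s⁻¹ t≤2a) ⟩
              (a + a) * suc w′                ≤⟨ m≤n+m _ (suc (suc (r + r))) ⟩
              suc (suc (r + r)) + (a + a) * suc w′  ≡⟨ regroup₂ r a w′ ⟨
              suc r + a * suc w′ + (suc r + a * suc w′) ∎))
      ... | tri≈ _ refl _ = subst₂ _<_ (sym (regroup₁ r a w′)) (sym 2m≡)
              (+-monoˡ-< ((a + a) * w′) (s≤s⁻¹ (<⇒≤ (+-cancelʳ-< ((a + a) * suc w′) (suc (suc (r + r))) (suc w′)
                 (subst (_< suc w′ + (a + a) * suc w′) (regroup₂ r a w′) 2x<)))))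
      ... | tri> _ _ 2a+2≤t = begin-strict
              r + a * w′ + (r + a * w′)   ≡⟨ regroup₁ r a w′ ⟩
              r + r + (a + a) * w′        <⟨ +-monoˡ-< _ (+-mono-< r<w′ r<w′) ⟩
              w′ + w′ + (a + a) * w′      ≡⟨ +-assoc w′ w′ _ ⟩
              suc (suc (a + a)) * w′      ≤⟨ *-monoˡ-≤ w′ 2a+2≤t ⟩
              t * w′                      ≡⟨ 2m≡ ⟨
              m + m                       ∎

module Signed {v t w′ m : ℕ} .{{_ : NonZero v}} .{{_ : NonZero w′}} .{{_ : NonZero m}}
  (v≡ : v ≡ t * suc w′) (2m≡ : m + m ≡ t * w′) where

  v≡2m+t : v ≡ m + m + t
  v≡2m+t = trans v≡ (trans (*-suc t w′) (trans (+-comm t (t * w′)) (cong (_+ t) (sym 2m≡))))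

  w∣v : suc w′ ∣ v
  w∣v = divides t v≡

  unrank-half-v : ∀ (i : Fin m) → unrank w′ (toℕ i) + unrank w′ (toℕ i) < v
  unrank-half-v i = subst (_ <_) (sym v≡) (unrank-half w′ {t} 2m≡ (toℕ i) (toℕ<n i))

  unrank<v : ∀ (i : Fin m) → unrank w′ (toℕ i) < v
  unrank<v i = ≤-<-trans (m≤m+n _ _) (unrank-half-v i)

  positive : Fin m → Fin v
  positive i = unrank w′ (toℕ i) mod v

  toℕ-positive : ∀ i → toℕ (positive i) ≡ unrank w′ (toℕ i)
  toℕ-positive i = toℕ-mod-< (unrank<v i)

  signed : Bool × Fin m → Fin v
  signed (true  , i) = positive i
  signed (false , i) = ⊝ positive i

  toℕ-negative : ∀ i → toℕ (⊝ positive i) ≡ v ∸ unrank w′ (toℕ i)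
  toℕ-negative i = trans
    (toℕ-⊝ (positive i) (λ eq → 1+n≢0 (trans (sym (toℕ-positive i)) eq)))
    (cong (v ∸_) (toℕ-positive i))

  locate : Fin v → Bool × Fin m
  locate z with toℕ z + toℕ z <? v
  ... | yes _ = true  , rank w′ (toℕ z) mod m
  ... | no  _ = false , rank w′ (v ∸ toℕ z) mod m

  rank-unrank-mod : ∀ (i : Fin m) → rank w′ (unrank w′ (toℕ i)) mod m ≡ i
  rank-unrank-mod i = trans (cong (_mod m) (rank-unrank w′ (toℕ i))) (mod-toℕ i)

  locate-signed : ∀ p → locate (signed p) ≡ p
  locate-signed (true  , i) with toℕ (positive i) + toℕ (positive i) <? v
  ... | yes _ = cong (true ,_) (trans (cong (λ x → rank w′ x mod m) (toℕ-positive i)) (rank-unrank-mod i))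
  ... | no ≮v = ⊥-elim (≮v (subst (λ x → x + x < v) (sym (toℕ-positive i)) (unrank-half-v i)))
  locate-signed (false , i) with toℕ (⊝ positive i) + toℕ (⊝ positive i) <? v
  ... | no  _ = cong (false ,_) (trans (cong (λ x → rank w′ x mod m)
      (trans (cong (v ∸_) (toℕ-negative i)) (m∸[m∸n]≡n (<⇒≤ (unrank<v i))))) (rank-unrank-mod i))
  ... | yes <v = ⊥-elim (<⇒≢ (+-mono-< (unrank-half-v i) (subst (λ x → x + x < v) (toℕ-negative i) <v))
      (sym (begin
        v + v                            ≡⟨ cong₂ _+_ split split ⟩
        (x + (v ∸ x)) + (x + (v ∸ x))    ≡⟨ interchange x (v ∸ x) ⟩
        x + x + ((v ∸ x) + (v ∸ x))      ∎)))
      where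
      open ≡-Reasoning
      x = unrank w′ (toℕ i)
      split : v ≡ x + (v ∸ x)
      split = sym (m+[n∸m]≡n (<⇒≤ (unrank<v i)))
      interchange : ∀ a b → (a + b) + (a + b) ≡ a + a + (b + b)
      interchange = solve-∀

  ∤-complement : ∀ {x} → x ≤ v → ¬ suc w′ ∣ x → ¬ suc w′ ∣ v ∸ x
  ∤-complement {x} x≤v w∤x d = w∤x (∣m+n∣m⇒∣n (subst (suc w′ ∣_) (sym (m∸n+n≡m x≤v)) w∣v) d)

  signed-∤ : ∀ p → ¬ suc w′ ∣ toℕ (signed p)
  signed-∤ (true  , i) = subst (λ x → ¬ suc w′ ∣ x) (sym (toℕ-positive i)) (unrank-∤ w′ (toℕ i))
  signed-∤ (false , i) = subst (λ x → ¬ suc w′ ∣ x) (sym (toℕ-negative i))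
    (∤-complement (<⇒≤ (unrank<v i)) (unrank-∤ w′ (toℕ i)))

  half-rank-v : ∀ {x} → ¬ suc w′ ∣ x → x + x < v → rank w′ x < m
  half-rank-v {x} w∤x 2x<v = half-rank w′ {t} 2m≡ x w∤x (subst (x + x <_) v≡ 2x<v)

  toℕ-positive-rank : ∀ {x} → ¬ suc w′ ∣ x → x + x < v → toℕ (positive (rank w′ x mod m)) ≡ x
  toℕ-positive-rank {x} w∤x 2x<v = begin
    toℕ (positive (rank w′ x mod m))    ≡⟨ toℕ-positive _ ⟩
    unrank w′ (toℕ (rank w′ x mod m))   ≡⟨ cong (unrank w′) (toℕ-mod-< (half-rank-v w∤x 2x<v)) ⟩
    unrank w′ (rank w′ x)               ≡⟨ unrank-rank w′ x w∤x ⟩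
    x                                   ∎
    where open ≡-Reasoning

  -- Since `v` is `m + m + t`, an element with `x + x ≡ v` would make `t` twice `x ∸ m`; halving
  -- `v ≡ t * suc w′` then makes `x` a multiple of `suc w′`.
  double≢v : ∀ {x} → ¬ suc w′ ∣ x → x + x ≢ v
  double≢v {x} w∤x 2x≡v = w∤x (divides (x ∸ m) (m+n≡m+n⇒ (begin
    x + x                                  ≡⟨ trans 2x≡v v≡ ⟩
    t * suc w′                             ≡⟨ cong (_* suc w′) t≡ ⟩
    (x ∸ m + (x ∸ m)) * suc w′             ≡⟨ *-distribʳ-+ (suc w′) (x ∸ m) (x ∸ m) ⟩
    (x ∸ m) * suc w′ + (x ∸ m) * suc w′    ∎)))
    where
    open ≡-Reasoning
    m+n≡m+n⇒ : ∀ {a b} → a + a ≡ b + b → a ≡ b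
    m+n≡m+n⇒ {a} {b} eq with <-cmp a b
    ... | tri< a<b _ _ = ⊥-elim (<⇒≢ (+-mono-< a<b a<b) eq)
    ... | tri≈ _ a≡b _ = a≡b
    ... | tri> _ _ b<a = ⊥-elim (>⇒≢ (+-mono-< b<a b<a) eq)
    m≤x : m ≤ x
    m≤x = ≮⇒≥ λ x<m → <⇒≱ (+-mono-< x<m x<m)
      (≤-trans (m≤m+n (m + m) t) (≤-reflexive (sym (trans 2x≡v v≡2m+t))))
    interchange : ∀ m d → m + d + (m + d) ≡ m + m + (d + d)
    interchange = solve-∀
    t≡ : t ≡ x ∸ m + (x ∸ m)
    t≡ = +-cancelˡ-≡ (m + m) t _ (begin
      m + m + t                    ≡⟨ trans (sym v≡2m+t) (sym 2x≡v) ⟩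
      x + x                        ≡⟨ cong (λ y → y + y) (m+[n∸m]≡n m≤x) ⟨
      m + (x ∸ m) + (m + (x ∸ m))  ≡⟨ interchange m (x ∸ m) ⟩
      m + m + (x ∸ m + (x ∸ m))    ∎)

  signed-locate : ∀ z → ¬ suc w′ ∣ toℕ z → signed (locate z) ≡ z
  signed-locate z w∤z with toℕ z + toℕ z <? v
  ... | yes 2z<v = toℕ-injective (toℕ-positive-rank w∤z 2z<v)
  ... | no  2z≮v = trans (cong ⊝_ (toℕ-injective (trans
          (toℕ-positive-rank (∤-complement z≤v w∤z) complement-half)
          (sym (toℕ-⊝ z λ eq → w∤z (subst (suc w′ ∣_) (sym eq) (suc w′ ∣0)))))))
        (⊝-involutive z)
    where
    z≤v : toℕ z ≤ v
    z≤v = <⇒≤ (toℕ<n z)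
    complement-half : v ∸ toℕ z + (v ∸ toℕ z) < v
    complement-half = +-cancelʳ-< (toℕ z + toℕ z) _ v (begin-strict
      v ∸ toℕ z + (v ∸ toℕ z) + (toℕ z + toℕ z)    ≡⟨ interchange (v ∸ toℕ z) (toℕ z) ⟩
      v ∸ toℕ z + toℕ z + (v ∸ toℕ z + toℕ z)      ≡⟨ cong (λ y → y + y) (m∸n+n≡m z≤v) ⟩
      v + v                                        <⟨ +-monoʳ-< v (≤∧≢⇒< (≮⇒≥ 2z≮v) (double≢v w∤z ∘ sym)) ⟩
      v + (toℕ z + toℕ z)                          ∎)
      where
      open ≤-Reasoning
      interchange : ∀ a b → a + a + (b + b) ≡ a + b + (a + b)
      interchange = solve-∀

  signed-not : ∀ b i → signed (not b , i) ≡ ⊝ signed (b , i)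
  signed-not true  i = refl
  signed-not false i = sym (⊝-involutive (positive i))

-- Labellings from ordered and signed half-sets

record Arrangement (m R : ℕ) .{{_ : NonZero m}} : Set where
  field
    order         : Permutation′ m
    sign          : Fin m → Bool
    -- Indices 0 and 1 belong to the elements 1 and 2, which must come first; signs are free from
    -- index `R` on.
    order-0       : order ⟨$⟩ʳ (0 mod m) ≡ 0 mod m
    order-1       : order ⟨$⟩ʳ (1 mod m) ≡ 1 mod m
    sign-positive : ∀ i → toℕ i < R → sign i ≡ true

module Arranged {v t w′ m R z : ℕ} .{{_ : NonZero v}} .{{_ : NonZero t}} .{{_ : NonZero w′}} .{{_ : NonZero m}}
  (v≡ : v ≡ t * suc w′) (2m≡ : m + m ≡ t * w′) (R≤m : R ≤ m)
  (v≡2R+z : v ≡ R + R + z) (t≤z : t ≤ z) (3≤z : 3 ≤ z) (z²≤R : z * z ≤ R) (2z+1≤w′ : z + z + 1 ≤ w′) where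

  open Signed {v} {t} {w′} {m} v≡ 2m≡

  t∣v : t ∣ v
  t∣v = divides (suc w′) (trans v≡ (*-comm t (suc w′)))

  v/t≡ : v / t ≡ suc w′
  v/t≡ = trans (cong (_/ t) (trans v≡ (*-comm t (suc w′)))) (m*n/n≡m (suc w′) t)

  1<w′ : 1 < w′
  1<w′ = ≤-trans (+-monoˡ-≤ 1 (≤-trans (≤-trans (s≤s z≤n) 3≤z) (m≤m+n z z))) 2z+1≤w′

  1<R : 1 < R
  1<R = ≤-trans (s≤s (s≤s z≤n)) (≤-trans (*-mono-≤ 3≤z 3≤z) z²≤R)

  toℕ-0 : toℕ (0 mod m) ≡ 0
  toℕ-0 = toℕ-mod-< (<-≤-trans (<-trans (s≤s z≤n) 1<R) R≤m)

  toℕ-1 : toℕ (1 mod m) ≡ 1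
  toℕ-1 = toℕ-mod-< (<-≤-trans 1<R R≤m)

  module _ (𝒜 : Arrangement m R) where

    open Arrangement 𝒜

    resign : Place m → Bool × Fin m
    resign (true  , j) = sign (order ⟨$⟩ʳ j) , order ⟨$⟩ʳ j
    resign (false , j) = not (sign (order ⟨$⟩ʳ (j ⊕ ⊝ 𝟙))) , order ⟨$⟩ʳ (j ⊕ ⊝ 𝟙)

    -- The Boolean says whether an element is the negative of the chosen one, so it is the opposite
    -- of the colour; `j ⊕ 𝟙` is the index offset of places of colour false.
    fromColour : Bool → Fin m → Place m
    fromColour false j = true , j
    fromColour true  j = false , j ⊕ 𝟙

    unsign : Bool × Fin m → Place m
    unsign (b , i) = fromColour (b xor sign i) (order ⟨$⟩ˡ i)

    unsign-resign : ∀ p → unsign (resign p) ≡ p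
    unsign-resign (true  , j) = cong₂ fromColour (xor-same (sign (order ⟨$⟩ʳ j))) (Perm.inverseˡ order)
    unsign-resign (false , j) =
      trans (cong₂ fromColour (xor-not (sign (order ⟨$⟩ʳ (j ⊕ ⊝ 𝟙)))) (Perm.inverseˡ order))
            (cong (false ,_) (x⊝y⊕y≡x 𝟙 j))
      where
      xor-not : ∀ b → not b xor b ≡ true
      xor-not true  = refl
      xor-not false = refl

    resign-unsign : ∀ p → resign (unsign p) ≡ p
    resign-unsign (b , i) = recolour b (sign i) refl
      where
      same : ∀ f → _≡_ {A = Bool × Fin m}
             (f (sign (order ⟨$⟩ʳ (order ⟨$⟩ˡ i))) , order ⟨$⟩ʳ (order ⟨$⟩ˡ i)) (f (sign i) , i)
      same f = cong (λ k → f (sign k) , k) (Perm.inverseʳ order)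
      flipped : _≡_ {A = Bool × Fin m} (resign (false , (order ⟨$⟩ˡ i) ⊕ 𝟙)) (not (sign i) , i)
      flipped = trans (cong (λ j → not (sign (order ⟨$⟩ʳ j)) , order ⟨$⟩ʳ j) (x⊕y⊝y≡x 𝟙 _)) (same not)
      recolour : ∀ b s → sign i ≡ s → resign (fromColour (b xor sign i) (order ⟨$⟩ˡ i)) ≡ (b , i)
      recolour true  true  eq rewrite eq = trans (same (λ b → b)) (cong (_, i) eq)
      recolour false false eq rewrite eq = trans (same (λ b → b)) (cong (_, i) eq)
      recolour true  false eq rewrite eq = trans flipped (cong (λ b → not b , i) eq)
      recolour false true  eq rewrite eq = trans flipped (cong (λ b → not b , i) eq)

    signed-resign-opp : ∀ p → signed (resign (opp p)) ≡ ⊝ signed (resign p)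
    signed-resign-opp (true  , j) = trans
      (cong (λ k → signed (not (sign (order ⟨$⟩ʳ k)) , order ⟨$⟩ʳ k)) (x⊕y⊝y≡x 𝟙 j))
      (signed-not (sign (order ⟨$⟩ʳ j)) (order ⟨$⟩ʳ j))
    signed-resign-opp (false , j) = trans (sym (⊝-involutive _)) (cong ⊝_ (sym (signed-not (sign i) i)))
      where i = order ⟨$⟩ʳ (j ⊕ ⊝ 𝟙)

    small-label : ∀ i x → order ⟨$⟩ʳ i ≡ i → toℕ i < R → unrank w′ (toℕ i) ≡ x →
                  signed (resign (true , i)) ≡ x mod v
    small-label i x fixed i<R eq = trans
      (cong signed (trans (cong (λ k → sign k , k) fixed) (cong (_, i) (sign-positive i i<R))))
      (cong (_mod v) eq)

    labelling : Labelling v t m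
    labelling = record
      { label       = signed ∘ resign
      ; place       = unsign ∘ locate
      ; place-label = λ p → trans (cong unsign (locate-signed (resign p))) (unsign-resign p)
      ; label-place = λ z w∤z → trans (cong signed (resign-unsign (locate z)))
                        (signed-locate z (subst (λ w → ¬ w ∣ toℕ z) v/t≡ w∤z))
      ; label-∤     = λ p → subst (λ w → ¬ w ∣ toℕ (signed (resign p))) (sym v/t≡) (signed-∤ (resign p))
      ; label-opp   = signed-resign-opp
      ; label-one   = small-label (0 mod m) 1 order-0 (subst (_< R) (sym toℕ-0) (<-trans (s≤s z≤n) 1<R))
          (trans (cong (unrank w′) toℕ-0) (cong suc (0/n≡0 w′)))
      ; label-two   = trans (small-label (1 mod m) 2 order-1 (subst (_< R) (sym toℕ-1) 1<R)
          (trans (cong (unrank w′) toℕ-1) (cong (λ k → suc (suc k)) (m<n⇒m/n≡0 1<w′)))) (mod-+ 1 1)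
      }

  module _ (𝒜 ℬ : Arrangement m R) where

    private
      module A = Arrangement 𝒜
      module B = Arrangement ℬ

    -- The index of `x` is smaller than `x`, so every element up to `R` outside J falls among the
    -- prescribed positive signs.
    sign-rank : (𝒞 : Arrangement m R) → ∀ {x} → 0 < x → x ≤ R → rank w′ x < m →
                Arrangement.sign 𝒞 (rank w′ x mod m) ≡ true
    sign-rank 𝒞 {x} 0<x x≤R rank<m = Arrangement.sign-positive 𝒞 _
      (subst (_< R) (sym (toℕ-mod-< rank<m)) (<-≤-trans (rank< w′ x 0<x) x≤R))

    R+R<v : R + R < v
    R+R<v = subst (R + R <_) (sym v≡2R+z) (m<m+n (R + R) (≤-trans (s≤s z≤n) 3≤z))

    label-of-small : ∀ {p} → 0 < p → p ≤ R → ¬ suc w′ ∣ p →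
      Σ[ j ∈ Fin m ] toℕ (signed (resign 𝒜 (true , j))) ≡ p
    label-of-small {p} 0<p p≤R w∤p = A.order ⟨$⟩ˡ i , (begin
      toℕ (signed (resign 𝒜 (true , A.order ⟨$⟩ˡ i)))  ≡⟨ cong (λ k → toℕ (signed (A.sign k , k))) (Perm.inverseʳ A.order) ⟩
      toℕ (signed (A.sign i , i))   ≡⟨ cong (λ b → toℕ (signed (b , i)))
                                          (sign-rank 𝒜 0<p p≤R (half-rank-v w∤p 2p<v)) ⟩
      toℕ (positive i)              ≡⟨ toℕ-positive-rank w∤p 2p<v ⟩
      p                             ∎)
      where
      open ≡-Reasoning
      i = rank w′ p mod m
      2p<v : p + p < v
      2p<v = ≤-<-trans (+-mono-≤ p≤R p≤R) R+R<v

    -- A positive label is below `v / 2`. A negative one belongs to an element above `R`, because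
    -- smaller elements are kept positive, and `v ∸ R` is `R + z`.
    label<R+z : ∀ j → toℕ (signed (resign ℬ (true , j))) < R + z
    label<R+z j = bound (B.sign i) refl
      where
      open ≤-Reasoning
      i = B.order ⟨$⟩ʳ j
      x = unrank w′ (toℕ i)
      v≡R+z+R : v ≡ R + z + R
      v≡R+z+R = trans v≡2R+z (rearrange R z)
        where
        rearrange : ∀ R z → R + R + z ≡ R + z + R
        rearrange = solve-∀
      bound : ∀ b → B.sign i ≡ b → toℕ (signed (b , i)) < R + z
      bound true  _  = subst (_< R + z) (sym (toℕ-positive i)) (≰⇒> λ R+z≤x → <⇒≱ (unrank-half-v i) (begin
        v                    ≡⟨ v≡R+z+R ⟩
        R + z + R            ≤⟨ +-monoʳ-≤ (R + z) (m≤m+n R z) ⟩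
        R + z + (R + z)      ≤⟨ +-mono-≤ R+z≤x R+z≤x ⟩
        x + x                ∎))
      bound false eq = subst (_< R + z) (sym (toℕ-negative i))
        (+-cancelʳ-< x (v ∸ x) (R + z) (subst (_< R + z + x) (sym (m∸n+n≡m (<⇒≤ (unrank<v i))))
        (subst (_< R + z + x) (sym v≡R+z+R) (+-monoʳ-< (R + z) (≰⇒> x≰R)))))
        where
        x≰R : ¬ x ≤ R
        x≰R x≤R with () ← trans (sym eq) (trans (cong B.sign (sym (rank-unrank-mod i)))
          (sign-rank ℬ (s≤s z≤n) x≤R (subst (_< m) (sym (rank-unrank w′ (toℕ i))) (toℕ<n i))))

    -- Every `p ≤ R` outside J is a label of colour true in `𝒜`, so its product with `u` is such a
    -- label in `ℬ`, hence nonzero and below `R + z`.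
    arrangements-rigid : Rigid t∣v (labelling 𝒜) (labelling ℬ)
    arrangements-rigid u E⊆E′ = toℕ-injective (trans
      (multiplier≡1 {v} {suc w′} {t} {R} {z} {toℕ u} v≡2R+z v≡ t≤z 3≤z z²≤R
        (subst (_≤ suc w′) (sym (+-suc (z + z) 1)) (s≤s 2z+1≤w′)) (toℕ<n u) confined)
      (sym (toℕ-mod-< (<-trans (<-≤-trans 1<R (m≤m+n R R)) R+R<v))))
      where
      confined : ∀ p → 0 < p → p ≤ R → ¬ suc w′ ∣ p → (p * toℕ u) % v ≢ 0 × (p * toℕ u) % v < R + z
      confined p 0<p p≤R w∤p
        with j , eq ← label-of-small 0<p p≤R w∤p
        with j′ , eq′ ← E⊆E′ j =
        (λ zero′ → signed-∤ (resign ℬ (true , j′)) (subst (suc w′ ∣_) (sym (trans toℕ≡ zero′)) (suc w′ ∣0))) ,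
        subst (_< R + z) toℕ≡ (label<R+z j′)
        where
        toℕ≡ : toℕ (signed (resign ℬ (true , j′))) ≡ (p * toℕ u) % v
        toℕ≡ = trans (cong toℕ eq′) (trans (toℕ-mod _) (cong (λ x → (x * toℕ u) % v) eq))

    labels-determine : (∀ p → signed (resign 𝒜 p) ≡ signed (resign ℬ p)) →
      (∀ j → A.order ⟨$⟩ʳ j ≡ B.order ⟨$⟩ʳ j) × (∀ i → A.sign i ≡ B.sign i)
    labels-determine eq = orders , λ i → begin
      A.sign i                                ≡⟨ cong A.sign (Perm.inverseʳ A.order) ⟨
      A.sign (A.order ⟨$⟩ʳ (A.order ⟨$⟩ˡ i))  ≡⟨ cong proj₁ (same (A.order ⟨$⟩ˡ i)) ⟩
      B.sign (B.order ⟨$⟩ʳ (A.order ⟨$⟩ˡ i))  ≡⟨ cong B.sign (orders (A.order ⟨$⟩ˡ i)) ⟨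
      B.sign (A.order ⟨$⟩ʳ (A.order ⟨$⟩ˡ i))  ≡⟨ cong B.sign (Perm.inverseʳ A.order) ⟩
      B.sign i                                ∎
      where
      open ≡-Reasoning
      same : ∀ j → resign 𝒜 (true , j) ≡ resign ℬ (true , j)
      same j = trans (sym (locate-signed _)) (trans (cong locate (eq (true , j))) (locate-signed _))
      orders : ∀ j → A.order ⟨$⟩ʳ j ≡ B.order ⟨$⟩ʳ j
      orders j = cong proj₂ (same j)

-- Counting

quotient-remainder-injective : ∀ {a} b {x y : Fin (a * b)} →
  quotient {a} b x ≡ quotient b y → remainder {a} b x ≡ remainder {a} b y → x ≡ y
quotient-remainder-injective {a} b {x} {y} q≡ r≡ = trans (sym (combine-remQuot {a} b x))
  (trans (cong₂ combine q≡ r≡) (combine-remQuot {a} b y))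

-- The leading digit is the image of `zero`; the other digits encode the permutation that remains
-- when this image is removed.
lehmer : ∀ k → Fin (k !) → Permutation′ k
lehmer zero    _ = Perm.id
lehmer (suc k) c = insert zero (quotient (k !) c) (lehmer k (remainder {suc k} (k !) c))

lehmer-injective : ∀ k c c′ → (∀ i → lehmer k c ⟨$⟩ʳ i ≡ lehmer k c′ ⟨$⟩ʳ i) → c ≡ c′
lehmer-injective zero    zero zero _ = refl
lehmer-injective (suc k) c c′ eq = quotient-remainder-injective (k !) (eq zero)
  (lehmer-injective k _ _ λ i → punchIn-injective (quotient (k !) c) _ _ (begin
    punchIn (quotient (k !) c) (π c ⟨$⟩ʳ i)     ≡⟨ insert-punchIn zero _ (π c) i ⟨
    lehmer (suc k) c ⟨$⟩ʳ suc i                 ≡⟨ eq (suc i) ⟩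
    lehmer (suc k) c′ ⟨$⟩ʳ suc i                ≡⟨ insert-punchIn zero _ (π c′) i ⟩
    punchIn (quotient (k !) c′) (π c′ ⟨$⟩ʳ i)   ≡⟨ cong (λ j → punchIn j (π c′ ⟨$⟩ʳ i)) (eq zero) ⟨
    punchIn (quotient (k !) c) (π c′ ⟨$⟩ʳ i)    ∎))
  where
  open ≡-Reasoning
  π : Fin (suc k !) → Permutation′ k
  π c = lehmer k (remainder {suc k} (k !) c)

bit : Fin 2 → Bool
bit zero    = true
bit (suc _) = false

bit-injective : ∀ {x y} → bit x ≡ bit y → x ≡ y
bit-injective {zero}     {zero}     _ = refl
bit-injective {suc zero} {suc zero} _ = refl

-- `opposite` counts from the top, so the bits fall on the `q` largest indices and the default
-- `true` keeps all others positive.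
topBits : ∀ {m q} → (Fin q → Fin 2) → Fin m → Bool
topBits {q = q} β i with toℕ (opposite i) <? q
... | yes <q = bit (β (fromℕ< <q))
... | no  _  = true

topBits-low : ∀ {m q R} (β : Fin q → Fin 2) → R + q ≡ m → ∀ (i : Fin m) → toℕ i < R → topBits β i ≡ true
topBits-low {m} {q} {R} β R+q≡m i i<R with toℕ (opposite i) <? q
... | no  _  = refl
... | yes <q = ⊥-elim (<⇒≱ <q (begin
  q                    ≡⟨ m+n∸m≡n R q ⟨
  R + q ∸ R            ≡⟨ cong (_∸ R) R+q≡m ⟩
  m ∸ R                ≤⟨ ∸-monoʳ-≤ m i<R ⟩
  m ∸ suc (toℕ i)      ≡⟨ opposite-prop i ⟨
  toℕ (opposite i)     ∎))
  where open ≤-Reasoning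

topBits-top : ∀ {m q} (β : Fin q → Fin 2) (q≤m : q ≤ m) k → topBits β (opposite (inject≤ k q≤m)) ≡ bit (β k)
topBits-top {m} {q} β q≤m k with toℕ (opposite (opposite (inject≤ k q≤m))) <? q
... | yes <q = cong (bit ∘ β) (toℕ-injective (trans (toℕ-fromℕ< <q) toℕ≡))
  where
  toℕ≡ : toℕ (opposite (opposite (inject≤ k q≤m))) ≡ toℕ k
  toℕ≡ = trans (cong toℕ (opposite-involutive (inject≤ k q≤m))) (toℕ-inject≤ k q≤m)
... | no  ≮q = ⊥-elim (≮q (subst (_< q)
    (sym (trans (cong toℕ (opposite-involutive (inject≤ k q≤m))) (toℕ-inject≤ k q≤m))) (toℕ<n k)))

finToFun-injective : ∀ m n {x y : Fin (m ℕ.^ n)} → (∀ i → finToFun {m} {n} x i ≡ finToFun y i) → x ≡ y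
finToFun-injective m zero    {zero} {zero} _ = refl
finToFun-injective m (suc n) eq = quotient-remainder-injective (m ℕ.^ n) (eq zero)
  (finToFun-injective m n (eq ∘ suc))

arrangements : ∀ m R q .{{_ : NonZero m}} → 1 < m → R + q ≡ m →
  Σ[ 𝒜 ∈ (Fin ((m ∸ 2) ! * 2 ℕ.^ q) → Arrangement m R) ] ∀ c c′ →
    (∀ j → Arrangement.order (𝒜 c) ⟨$⟩ʳ j ≡ Arrangement.order (𝒜 c′) ⟨$⟩ʳ j) →
    (∀ i → Arrangement.sign (𝒜 c) i ≡ Arrangement.sign (𝒜 c′) i) → c ≡ c′
arrangements (suc zero)       R q (s≤s ())
arrangements m@(suc (suc m₀)) R q _ R+q≡m = 𝒜 , injective
  where
  N = m₀ ! * 2 ℕ.^ q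
  orderCode : Fin N → Fin (m₀ !)
  orderCode = quotient (2 ℕ.^ q)
  signBits : Fin N → Fin q → Fin 2
  signBits = finToFun ∘ remainder {m₀ !} (2 ℕ.^ q)
  𝒜 : Fin N → Arrangement m R
  𝒜 c = record
    -- The two lifts fix the positions of 1 and 2, so only `m₀` positions are permuted.
    { order         = lift₀ (lift₀ (lehmer m₀ (orderCode c)))
    ; sign          = topBits (signBits c)
    ; order-0       = refl
    ; order-1       = refl
    ; sign-positive = topBits-low (signBits c) R+q≡m }
  q≤m : q ≤ m
  q≤m = subst (q ≤_) R+q≡m (m≤n+m q R)
  injective : ∀ c c′ →
    (∀ j → Arrangement.order (𝒜 c) ⟨$⟩ʳ j ≡ Arrangement.order (𝒜 c′) ⟨$⟩ʳ j) →
    (∀ i → Arrangement.sign (𝒜 c) i ≡ Arrangement.sign (𝒜 c′) i) → c ≡ c′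
  injective c c′ orders signs = quotient-remainder-injective (2 ℕ.^ q)
    (lehmer-injective m₀ _ _ λ i → suc-injective (suc-injective (orders (suc (suc i)))))
    (finToFun-injective 2 q λ k → bit-injective (trans (sym (topBits-top (signBits c) q≤m k))
      (trans (signs _) (topBits-top (signBits c′) q≤m k))))

-- Two fixed positions cost a factor m (m - 1), which the sign bits regain.
factorial≤count : ∀ m q → 1 < m → m * m ≤ 2 ℕ.^ q → m ! ≤ (m ∸ 2) ! * 2 ℕ.^ q
factorial≤count (suc zero) q (s≤s ())
factorial≤count m@(suc (suc m₀)) q _ m²≤2^q = begin
  m * (suc m₀ * m₀ !)   ≡⟨ *-assoc m (suc m₀) (m₀ !) ⟨
  m * suc m₀ * m₀ !     ≤⟨ *-monoˡ-≤ (m₀ !) (≤-trans (*-monoʳ-≤ m (n≤1+n (suc m₀))) m²≤2^q) ⟩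
  2 ℕ.^ q * m₀ !          ≡⟨ *-comm (2 ℕ.^ q) (m₀ !) ⟩
  m₀ ! * 2 ℕ.^ q          ∎
  where open ≤-Reasoning

-- Number of sign bits

ceiling-log : ∀ m → 0 < m → Σ[ ℓ ∈ ℕ ] (m ≤ 2 ℕ.^ ℓ × 2 ℕ.^ ℓ < 2 * m)
ceiling-log (suc zero) _ = 0 , ≤-refl , ≤-refl
ceiling-log (suc m@(suc _)) _ with ceiling-log m (s≤s z≤n)
... | ℓ , m≤ , <2m with suc m ≤? 2 ℕ.^ ℓ
...   | yes m< = ℓ , m< , <-trans <2m (*-monoʳ-< 2 (n<1+n m))
...   | no  m≮ = suc ℓ , ≤-trans (+-mono-≤ (m^n>0 2 ℓ) m≤) (≤-reflexive (cong (λ x → 2 ℕ.^ ℓ + x) (sym (+-identityʳ _))))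
          , *-monoʳ-< 2 (≰⇒> m≮)

n<2^n : ∀ n → n < 2 ℕ.^ n
n<2^n zero    = s≤s z≤n
n<2^n (suc n) = ≤-trans (+-mono-≤ (m^n>0 2 n) (n<2^n n)) (≤-reflexive (cong (λ x → 2 ℕ.^ n + x) (sym (+-identityʳ _))))

-- This is the cube of `n ≤ 3 * 2 ^ (n / 3)`.
cube≤27*2^ : ∀ n → n * n * n ≤ 27 * 2 ℕ.^ n
cube≤27*2^ n = begin
  n * n * n                              ≤⟨ *-mono-≤ (*-mono-≤ n≤3a n≤3a) n≤3a ⟩
  3 * a * (3 * a) * (3 * a)              ≡⟨ expand a ⟩
  27 * (a * a * a)                       ≡⟨ cong (27 *_) (trans (cong (_* a) (sym (^-distribˡ-+-* 2 j j))) (sym (^-distribˡ-+-* 2 (j + j) j))) ⟩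
  27 * 2 ℕ.^ (j + j + j)                   ≤⟨ *-monoʳ-≤ 27 (^-monoʳ-≤ 2 3j≤n) ⟩
  27 * 2 ℕ.^ n                             ∎
  where
  open ≤-Reasoning
  j = n / 3
  a = 2 ℕ.^ j
  expand : ∀ a → 3 * a * (3 * a) * (3 * a) ≡ 27 * (a * a * a)
  expand = solve-∀
  triple : ∀ j → j * 3 ≡ j + j + j
  triple = solve-∀
  3j≤n : j + j + j ≤ n
  3j≤n = ≤-trans (≤-reflexive (sym (triple j))) (m/n*n≤m n 3)
  n≤3a : n ≤ 3 * a
  n≤3a = begin
    n                ≡⟨ m≡m%n+[m/n]*n n 3 ⟩
    n % 3 + j * 3    ≤⟨ +-monoˡ-≤ (j * 3) (<⇒≤ (m%n<n n 3)) ⟩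
    suc j * 3        ≡⟨ *-comm (suc j) 3 ⟩
    3 * suc j        ≤⟨ *-monoʳ-≤ 3 (n<2^n j) ⟩
    3 * a            ∎

-- With `ℓ` the binary logarithm of `m` rounded up, `q = ℓ + ℓ` gives `m * m ≤ 2 ^ q`. As `t ≤ ℓ`,
-- `z` is at most `5 * ℓ` and `z * z + z` at most `30 * (ℓ * ℓ)`. The cube of `ℓ` is at most
-- `27 * 2 ^ ℓ`, below `54 * m`, which suffices once `ℓ` reaches 1620 = 54 * 30.
sign-bits : ∀ t .{{_ : NonZero t}} L → t ≤ L → 1620 ≤ L → ∀ m → 2 ℕ.^ L ≤ m →
  Σ[ q ∈ ℕ ] (m * m ≤ 2 ℕ.^ q × 0 < q × (let z = q + q + t in z * z + z ≤ m))
sign-bits t L t≤L 1620≤L m 2^L≤m with ceiling-log m (≤-trans (m^n>0 2 L) 2^L≤m)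
... | ℓ , m≤ , <2m = ℓ + ℓ , ≤-trans (*-mono-≤ m≤ m≤) (≤-reflexive (sym (^-distribˡ-+-* 2 ℓ ℓ))) ,
      ≤-trans 0<ℓ (m≤m+n ℓ ℓ) , *-cancelˡ-≤ 54 (begin
        54 * (z * z + z)                     ≤⟨ *-monoʳ-≤ 54 (+-mono-≤ (*-mono-≤ z≤5ℓ z≤5ℓ) (≤-trans z≤5ℓ (m≤m*n (5 * ℓ) ℓ {{>-nonZero 0<ℓ}}))) ⟩
        54 * (5 * ℓ * (5 * ℓ) + 5 * ℓ * ℓ)   ≡⟨ expand ℓ ⟩
        1620 * (ℓ * ℓ)                       ≤⟨ *-monoˡ-≤ (ℓ * ℓ) (≤-trans 1620≤L L≤ℓ) ⟩
        ℓ * (ℓ * ℓ)                          ≡⟨ *-assoc ℓ ℓ ℓ ⟨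
        ℓ * ℓ * ℓ                            ≤⟨ cube≤27*2^ ℓ ⟩
        27 * 2 ℕ.^ ℓ                           ≤⟨ *-monoʳ-≤ 27 (<⇒≤ <2m) ⟩
        27 * (2 * m)                         ≡⟨ *-assoc 27 2 m ⟨
        54 * m                               ∎)
  where
  open ≤-Reasoning
  z = ℓ + ℓ + (ℓ + ℓ) + t
  expand : ∀ ℓ → 54 * (5 * ℓ * (5 * ℓ) + 5 * ℓ * ℓ) ≡ 1620 * (ℓ * ℓ)
  expand = solve-∀
  collect : ∀ ℓ → ℓ + ℓ + (ℓ + ℓ) + ℓ ≡ 5 * ℓ
  collect = solve-∀
  L≤ℓ : L ≤ ℓ
  L≤ℓ = ≮⇒≥ λ ℓ<L → <⇒≱ (^-monoʳ-< 2 (s≤s (s≤s z≤n)) ℓ<L) (≤-trans 2^L≤m m≤)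
  t≤ℓ : t ≤ ℓ
  t≤ℓ = ≤-trans t≤L L≤ℓ
  0<ℓ : 0 < ℓ
  0<ℓ = ≤-trans (>-nonZero⁻¹ t) t≤ℓ
  z≤5ℓ : z ≤ 5 * ℓ
  z≤5ℓ = ≤-trans (+-monoʳ-≤ (ℓ + ℓ + (ℓ + ℓ)) t≤ℓ) (≤-reflexive (collect ℓ))

-- Comparison of rational bounds with counts

/-≤ : ∀ a b c d .{{_ : NonZero b}} .{{_ : NonZero d}} → a * d ≤ c * b → (+ a) ℚ./ b ℚ.≤ (+ c) ℚ./ d
/-≤ a b@(suc b-1) c d@(suc d-1) ad≤cb = ℚ.toℚᵘ-cancel-≤ (begin
  ℚ.toℚᵘ (ℚ.fromℚᵘ (ℚᵘ.mkℚᵘ (+ a) b-1))  ≃⟨ ℚ.toℚᵘ-fromℚᵘ (ℚᵘ.mkℚᵘ (+ a) b-1) ⟩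
  ℚᵘ.mkℚᵘ (+ a) b-1                      ≤⟨ ℚᵘ.*≤* (subst₂ ℤ._≤_ (ℤ.pos-* a d) (ℤ.pos-* c b) (ℤ.+≤+ ad≤cb)) ⟩
  ℚᵘ.mkℚᵘ (+ c) d-1                      ≃⟨ ℚ.toℚᵘ-fromℚᵘ (ℚᵘ.mkℚᵘ (+ c) d-1) ⟨
  ℚ.toℚᵘ (ℚ.fromℚᵘ (ℚᵘ.mkℚᵘ (+ c) d-1))  ∎)
  where open ℚᵘ.≤-Reasoning

module _ (a v : ℕ) .{{_ : NonZero v}} where

  private instance
    2φ≢0 : NonZero (2 * φ v)
    2φ≢0 = m*n≢0 2 (φ v) {{_}} {{φ-nonZero v}}

  ratio-nonNeg : ℚ.NonNegative (a !/2φ v)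
  ratio-nonNeg = ℚ.normalize-nonNeg (a !) (2 * φ v)

  -- The denominator is at least 1, so a count of `a !` already exceeds the quotient.
  ratio≤ : ∀ {N} → a ! ≤ N → a !/2φ v ℚ.≤ (+ N) ℚ./ 1
  ratio≤ {N} a!≤N = /-≤ (a !) (2 * φ v) N 1
    (≤-trans (≤-reflexive (*-identityʳ (a !))) (≤-trans a!≤N (m≤m*n N (2 * φ v))))

  scaled≤ : ∀ {r N} → r ℚ.≤ 1ℚ → a ! ≤ N → r ℚ.* (a !/2φ v) ℚ.≤ (+ N) ℚ./ 1
  scaled≤ {r} r≤1 a!≤N = ℚ.≤-trans (ℚ.*-monoʳ-≤-nonNeg (a !/2φ v) {{ratio-nonNeg}} r≤1)
    (ℚ.≤-trans (ℚ.≤-reflexive (ℚ.*-identityˡ (a !/2φ v))) (ratio≤ a!≤N))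

  scaled≤0 : ∀ {r} → r ℚ.≤ 0ℚ → r ℚ.* (a !/2φ v) ℚ.≤ (+ 0) ℚ./ 1
  scaled≤0 {r} r≤0 = ℚ.≤-trans (ℚ.*-monoʳ-≤-nonNeg (a !/2φ v) {{ratio-nonNeg}} r≤0)
    (ℚ.≤-reflexive (ℚ.*-zeroˡ (a !/2φ v)))

1-p≤1 : ∀ {p} → 0ℚ ℚ.≤ p → 1ℚ ℚ.- p ℚ.≤ 1ℚ
1-p≤1 0≤p = ℚ.≤-trans (ℚ.+-monoʳ-≤ 1ℚ (ℚ.neg-antimono-≤ 0≤p)) (ℚ.≤-reflexive (ℚ.+-identityʳ 1ℚ))

1-p≤0 : ∀ {p} → 1ℚ ℚ.≤ p → 1ℚ ℚ.- p ℚ.≤ 0ℚ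
1-p≤0 1≤p = ℚ.≤-trans (ℚ.+-monoʳ-≤ 1ℚ (ℚ.neg-antimono-≤ 1≤p)) (ℚ.≤-reflexive (ℚ.+-inverseʳ 1ℚ))

-- Families of embeddings and the lower bounds

Family : (v t k N : ℕ) .{{_ : NonZero v}} .{{_ : NonZero t}} → Set
Family v t k N = Σ[ Π ∈ (Fin N → Embedding (completeMultipartite v t)) ]
  (∀ i → GoodBiembedding v t k (Π i)) × (∀ i j → i ≢ j → ¬ Isomorphism (Π i) (Π j))

-- With `R = m ∸ q` the number `z = q + q + t` is exactly `v ∸ (R + R)`. The single inequality
-- `z * z + z ≤ m` yields both `z * z ≤ R`, through `q ≤ z`, and `z + z + 1 ≤ w′`, through `t ≤ z`.
family : ∀ t .{{_ : NonZero t}} v m q .{{_ : NonZero v}} .{{_ : NonZero m}} → m % 2 ≡ 1 →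
  t ∣ m + m → v ≡ m + m + t → 0 < q → (let z = q + q + t in z * z + z ≤ m) →
  ∀ k → k ∣ m → Family v t k ((m ∸ 2) ! * 2 ℕ.^ q)
family t v m q m-odd (divides w′ 2m≡′) v≡2m+t 0<q small k k∣m =
  Π , good , distinct
  where
  open ≤-Reasoning
  R z : ℕ
  R = m ∸ q
  z = q + q + t
  t≤z : t ≤ z
  t≤z = m≤n+m t (q + q)
  3≤z : 3 ≤ z
  3≤z = +-mono-≤ (+-mono-≤ 0<q 0<q) (>-nonZero⁻¹ t)
  q≤z : q ≤ z
  q≤z = ≤-trans (m≤m+n q q) (m≤m+n (q + q) t)
  q≤m : q ≤ m
  q≤m = ≤-trans q≤z (≤-trans (m≤n+m z (z * z)) small)
  R+q≡m : R + q ≡ m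
  R+q≡m = m∸n+n≡m q≤m
  3<m : 3 < m
  3<m = ≤-trans (≤-trans (s≤s (s≤s (s≤s (s≤s z≤n)))) (+-mono-≤ (*-mono-≤ 3≤z 3≤z) 3≤z)) small
  1<m : 1 < m
  1<m = <-trans (s≤s (s≤s z≤n)) 3<m
  z²≤R : z * z ≤ R
  z²≤R = +-cancelʳ-≤ q (z * z) R (begin
    z * z + q   ≤⟨ +-monoʳ-≤ (z * z) q≤z ⟩
    z * z + z   ≤⟨ small ⟩
    m           ≡⟨ R+q≡m ⟨
    R + q       ∎)
  2m≡ : m + m ≡ t * w′
  2m≡ = trans 2m≡′ (*-comm w′ t)
  v≡ : v ≡ t * suc w′
  v≡ = trans v≡2m+t (trans (cong (_+ t) 2m≡) (trans (+-comm (t * w′) t) (sym (*-suc t w′))))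
  v≡2R+z : v ≡ R + R + z
  v≡2R+z = trans v≡2m+t (trans (cong (λ x → x + x + t) (sym R+q≡m)) (rearrange R q t))
    where
    rearrange : ∀ R q t → R + q + (R + q) + t ≡ R + R + (q + q + t)
    rearrange = solve-∀
  2z+1≤w′ : z + z + 1 ≤ w′
  2z+1≤w′ = *-cancelˡ-≤ t (begin
    t * (z + z + 1)       ≤⟨ *-monoˡ-≤ (z + z + 1) t≤z ⟩
    z * (z + z + 1)       ≤⟨ m≤m+n _ z ⟩
    z * (z + z + 1) + z   ≡⟨ expand z ⟩
    z * z + z + (z * z + z) ≤⟨ +-mono-≤ small small ⟩
    m + m                 ≡⟨ 2m≡ ⟩
    t * w′                ∎)
    where
    expand : ∀ z → z * (z + z + 1) + z ≡ z * z + z + (z * z + z)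
    expand = solve-∀
  instance
    w′≢0 : NonZero w′
    w′≢0 = >-nonZero (≤-trans (m≤n+m 1 (z + z)) 2z+1≤w′)
  R≤m : R ≤ m
  R≤m = m∸n≤m m q

  open Arranged {v} {t} {w′} {m} {R} {z} v≡ 2m≡ R≤m v≡2R+z t≤z 3≤z z²≤R 2z+1≤w′

  𝒜s = arrangements m R q 1<m R+q≡m
  𝒜 = proj₁ 𝒜s

  embed : Arrangement m R → Embedding (completeMultipartite v t)
  embed ℬ = FromLabelling.embedding t∣v (labelling ℬ)

  rigidity : ∀ ℬ 𝒞 → (α : Isomorphism (embed ℬ) (embed 𝒞)) → _
  rigidity ℬ 𝒞 = isomorphism⇒≗ t∣v (labelling ℬ) (labelling 𝒞) 3<m
    (arrangements-rigid ℬ 𝒞)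

  Π : Fin ((m ∸ 2) ! * 2 ℕ.^ q) → Embedding (completeMultipartite v t)
  Π c = embed (𝒜 c)

  good : ∀ c → GoodBiembedding v t k (Π c)
  -- Comparing an embedding with itself shows that each automorphism is the translation by its image
  -- of 0.
  good c = isBiembedding , (translation , λ α → _ , proj₂ (rigidity (𝒜 c) (𝒜 c) α)) ,
    λ e ℓ length-ℓ → ∣-trans k∣m (face-length m-odd e ℓ length-ℓ)
    where open FromLabelling t∣v (labelling (𝒜 c))

  distinct : ∀ c c′ → c ≢ c′ → ¬ Isomorphism (Π c) (Π c′)
  distinct c c′ c≢c′ α = c≢c′ (proj₂ 𝒜s c c′ (proj₁ agree) (proj₂ agree))
    where
    agree = labels-determine (𝒜 c) (𝒜 c′)
      (proj₁ (rigidity (𝒜 c) (𝒜 c′) α))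

nk-odd : ∀ {t n k} → Admissible t n k → (n * k) % 2 ≡ 1
nk-odd (_ , _ , inj₁ (odd , _))        = odd
nk-odd (_ , _ , inj₂ (inj₁ (odd , _))) = odd
nk-odd (_ , _ , inj₂ (inj₂ (odd , _))) = odd

LargeFamilies : (t M : ℕ) .{{_ : NonZero t}} → Set
LargeFamilies t M = (n k v : ℕ) .{{_ : NonZero n}} .{{_ : NonZero k}} .{{_ : NonZero v}} →
  Admissible t n k → v ≡ 2 * n * k + t → M ≤ n * k →
  Σ[ N ∈ ℕ ] ((n * k) ! ≤ N × Family v t k N)

-- The threshold forces the binary logarithm of `n * k` to reach both `t` and 1620, as the choice of
-- sign bits requires.
large-families : ∀ t .{{_ : NonZero t}} → Σ[ M ∈ ℕ ] LargeFamilies t M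
large-families t = 2 ℕ.^ (t ⊔ 1620) , λ n k v adm v≡ M≤m →
  let instance _ = m*n≢0 n k
      q , m²≤2^q , 0<q , small = sign-bits t (t ⊔ 1620) (m≤m⊔n t 1620) (m≤n⊔m t 1620) (n * k) M≤m
      1<m = ≤-trans (≤-trans (s≤s (s≤s z≤n)) (^-monoʳ-≤ 2 {1} {t ⊔ 1620} (≤-trans (s≤s z≤n) (m≤n⊔m t 1620)))) M≤m
      2nk≡ = double n k
  in (n * k ∸ 2) ! * 2 ℕ.^ q , factorial≤count (n * k) q 1<m m²≤2^q ,
     family t v (n * k) q (nk-odd {t} {n} {k} adm) (subst (t ∣_) 2nk≡ (proj₁ (proj₂ adm)))
       (trans v≡ (cong (_+ t) 2nk≡)) 0<q small k (n∣m*n n)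
  where
  double : ∀ n k → 2 * n * k ≡ n * k + n * k
  double = solve-∀

-- The constant of the O-term can be M itself: the bound is void when n k < M.
bounded-below : ∀ t M .{{_ : NonZero t}} → LargeFamilies t M →
  (n k v : ℕ) .{{_ : NonZero n}} .{{_ : NonZero k}} .{{_ : NonZero v}} →
  Admissible t n k → v ≡ 2 * n * k + t →
  NonIsomorphic≥ (GoodBiembedding v t k)
    ((1ℚ ℚ.- (ℚ._/_ (+ M) (n * k) {{m*n≢0 n k}})) ℚ.* ((n * k) !/2φ v))
bounded-below t M large n k v adm v≡ = by-size (M ≤? n * k)
  where
  by-size : Dec (M ≤ n * k) → NonIsomorphic≥ (GoodBiembedding v t k)
    ((1ℚ ℚ.- (ℚ._/_ (+ M) (n * k) {{m*n≢0 n k}})) ℚ.* ((n * k) !/2φ v))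
  by-size (yes M≤nk) =
    let N , count , Π , good , distinct = large n k v adm v≡ M≤nk
    in N , Π , good , distinct , scaled≤ (n * k) v
         (1-p≤1 (/-≤ 0 1 M (n * k) {{_}} {{m*n≢0 n k}} z≤n)) count
  by-size (no M≰nk) = 0 , (λ ()) , (λ ()) , (λ ()) , scaled≤0 (n * k) v
    (1-p≤0 (/-≤ 1 1 M (n * k) {{_}} {{m*n≢0 n k}} (subst₂ _≤_
      (sym (*-identityˡ (n * k))) (sym (*-identityʳ M)) (<⇒≤ (≰⇒> M≰nk)))))

-- The families have at least `(n * k) !` members, so the factor `1ℚ ℚ.- ε` is bounded by 1 and one
-- threshold serves every `ε`.
asymptotic-below : ∀ t M .{{_ : NonZero t}} → LargeFamilies t M → ∀ ε → 0ℚ ℚ.< ε →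
  (n k v : ℕ) .{{_ : NonZero n}} .{{_ : NonZero k}} .{{_ : NonZero v}} →
  Admissible t n k → v ≡ 2 * n * k + t → M ≤ n * k →
  NonIsomorphic≥ (GoodBiembedding v t k) ((1ℚ ℚ.- ε) ℚ.* (((v ∸ t) ℕ./ 2) !/2φ v))
asymptotic-below t M large ε 0<ε n k v adm v≡ M≤nk =
  let N , count , Π , good , distinct = large n k v adm v≡ M≤nk
  in N , Π , good , distinct , scaled≤ ((v ∸ t) ℕ./ 2) v (1-p≤1 (ℚ.<⇒≤ 0<ε))
       (subst (λ m → m ! ≤ N) (sym half) count)
  where
  half : (v ∸ t) ℕ./ 2 ≡ n * k
  half = trans (cong (λ x → (x ∸ t) ℕ./ 2) v≡) (trans (cong (ℕ._/ 2) (trans (m+n∸n≡m (2 * n * k) t)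
    (trans (*-assoc 2 n k) (*-comm 2 (n * k))))) (m*n/n≡m (n * k) 2))

theorem5p7 : (t : ℕ) .{{_ : NonZero t}} → t % 4 ≢ 0 →
    (Σ[ C ∈ ℕ ]
    ((n k v : ℕ) .{{_ : NonZero n}} .{{_ : NonZero k}} .{{_ : NonZero v}} →
    Admissible t n k → v ≡ 2 * n * k + t →
    NonIsomorphic≥ (GoodBiembedding v t k)
    ((1ℚ ℚ.- (ℚ._/_ (+ C) (n * k) {{m*n≢0 n k}})) ℚ.* ((n * k) !/2φ v))))
    ×
    ((ε : ℚ) → 0ℚ ℚ.< ε →
    Σ[ M ∈ ℕ ]
    ((n k v : ℕ) .{{_ : NonZero n}} .{{_ : NonZero k}} .{{_ : NonZero v}} →
    Admissible t n k → v ≡ 2 * n * k + t → M ≤ n * k →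
    NonIsomorphic≥ (GoodBiembedding v t k)
    ((1ℚ ℚ.- ε) ℚ.* (((v ∸ t) ℕ./ 2) !/2φ v))))
theorem5p7 t _ =
  (proj₁ (large-families t) , bounded-below t _ (proj₂ (large-families t))) ,
  λ ε 0<ε → proj₁ (large-families t) , asymptotic-below t _ (proj₂ (large-families t)) ε 0<ε
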